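{- There exist an absolute constant $C>0$ and infinitely many positive integers $n$ for which there is an order-$n$ Latin square $L$ with $\varepsilon(L)\le C n^2$ (and hence, since every Latin square has $\varepsilon(L)=\Omega(n^2)$, $\varepsilon(L)=\Theta(n^2)$).
   Context: Write $[n]=\{1,\dots,n\}$. An order-$n$ Latin square is a map $L:[n]\times[n]\to[n]$ such that for each fixed $i$ the map $j\mapsto L(i,j)$ is a bijection and for each fixed $j$ the map $i\mapsto L(i,j)$ is a bijection. For $X,Y,Z\subseteq[n]$, the box $X\times Y\times Z$ is called an empty box of $L$ if there are no $i\in X$, $j\in Y$ with $L(i,j)\in Z$; its volume is $|X||Y||Z|$. $\varepsilon(L)$ denotes the maximum volume of an empty box of $L$. -}

module Defs where

open import Data.Nat using (ℕ; _*_)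
open import Data.Fin using (Fin)
open import Data.Fin.Subset using (Subset; _∈_; ∣_∣)
open import Data.Product using (_×_)
open import Relation.Binary.PropositionalEquality using (_≡_)
open import Relation.Nullary using (¬_)
open import Function.Definitions using (Bijective)

record LatinSquare (n : ℕ) : Set where
  field
    L      : Fin n → Fin n → Fin n
    rowBij : ∀ i → Bijective _≡_ _≡_ (λ j → L i j)
    colBij : ∀ j → Bijective _≡_ _≡_ (λ i → L i j)
open LatinSquare public

IsEmptyBox : ∀ {n} → LatinSquare n → Subset n → Subset n → Subset n → Set
IsEmptyBox Sq X Y Z = ∀ i j → i ∈ X → j ∈ Y → ¬ (L Sq i j ∈ Z)

volume : ∀ {n} → Subset n → Subset n → Subset n → ℕ
volume X Y Z = ∣ X ∣ * ∣ Y ∣ * ∣ Z ∣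

-- ε(L) ≤ b  ⇔  every empty box of L has volume ≤ b (ε is a maximum over a finite, nonempty set).
open import Data.Nat using (_≤_)
εBoundedBy : ∀ {n} → LatinSquare n → ℕ → Set
εBoundedBy Sq b = ∀ X Y Z → IsEmptyBox Sq X Y Z → volume X Y Z ≤ b

{-# OPTIONS --safe #-}
-- Fix a prime p and m = ⌊p / 48⌋, and let rows, columns and symbols be three
-- families of lines of the affine plane over ℤ/p, each with m slopes, no slope
-- being shared by two families; so n = m p.  A row and a column meet in one
-- point β, and through β pass m lines of each family, so choosing a Latin
-- square of order m at each of the p² points yields one of order n.  At β we
-- take σ (a + τ c) with independent random permutations τ and σ.  There are 8ⁿ
-- boxes, so if each box of volume > C n² is empty with probability ≤ 16⁻ⁿ, then
-- some choice leaves no such box empty.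
--
-- Let x, y, z be the numbers of lines of X, Y, Z through β.  The local square
-- misses the local box with probability at most (1 − z/m)^y if x ≥ 1 (and
-- symmetrically), and at most 3/4 if x y z ≥ m.  Two lines meet at most once,
-- so Σ x² ≤ p |X| + |X|² over the points; hence by Chebyshev
-- all but 4p³/|X| points have x ≥ |X|/2p.  If |X|, |Y|, |Z| ≥ 16p, a quarter of
-- the points have x y z ≥ m, and (3/4)^(p²/4) ≤ 16⁻ⁿ.  If, say, |X| < 16p,
-- then X touches at least p|X|/17 points, at half of which y and z are at least
-- half their means, and the first bound gives exp(−Ω(C n)).
module Submission where

open import Defs
open import Data.Nat using (ℕ; _*_; _≤_; _<_)
open import Data.Product using (Σ; ∃; _×_)
open import Data.Nat using (zero; suc; pred; _+_; _∸_; _^_; _!; _≤?_; z≤n; s≤s; NonZero; ≢-nonZero; ≢-nonZero⁻¹; >-nonZero; >-nonZero⁻¹; nonTrivial⇒n>1)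
open import Data.Nat.Properties hiding (suc-injective) renaming (_≟_ to _≟ⁿ_)
open import Data.Nat.Properties using () renaming (suc-injective to ℕ-suc-injective)
open import Data.Nat.Divisibility using (_∣_; divides; ∣-trans; m∣m*n; ∣1⇒≡1; ∣m+n∣m⇒∣n; m≤n⇒m!∣n!; ∣⇒≤)
open import Data.Nat.DivMod using (_/_; _%_; m≡m%n+[m/n]*n; m%n<n; m/n*n≤m; %-distribˡ-+; m≥n⇒m/n>0)
open import Data.Nat.Primality using (Prime; euclidsLemma; prime⇒nonZero; prime⇒nonTrivial; ¬prime[0]; ¬prime[1])
open import Data.Nat.Primality.Factorisation using (factorise)
open import Data.Nat.Tactic.RingSolver using (solve-∀)
open import Data.Bool using (Bool; true; false; if_then_else_; not; _∧_)
open import Data.Bool.Properties using () renaming (_≟_ to _≟ᵇ_)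
open import Data.Fin using (Fin; zero; suc; punchIn; punchOut; _↑ˡ_; _↑ʳ_; combine; remQuot; toℕ; fromℕ<)
open import Data.Fin.Properties using (any?; punchIn-injective; punchInᵢ≢i; punchIn-punchOut; punchOut-injective; injective⇒≤; suc-injective; toℕ-injective; toℕ<n; toℕ-fromℕ<; combine-injective; combine-surjective; combine-remQuot; remQuot-combine) renaming (_≟_ to _≟ᶠ_)
open import Data.Fin.Subset using (Subset; ∣_∣) renaming (_∈_ to _∈ₛ_)
open import Data.Fin.Subset.Properties using (∣p∣≤n)
open import Data.List using (List; []; _∷_; _++_; map; length; allFin; tabulate; cartesianProduct; cartesianProductWith)
open import Data.List.Properties using (length-map; length-++; length-tabulate)
open import Data.List.Membership.Propositional using (_∈_)
open import Data.List.Membership.Propositional.Properties using (∈-allFin; ∈-cartesianProductWith⁺; ∈-cartesianProduct⁺)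
open import Data.List.Relation.Unary.All using () renaming (_∷_ to _∷ᵃ_)
open import Data.List.Relation.Unary.Any using (here; there)
open import Data.Vec using (lookup; []; _∷_)
open import Data.Vec.Properties using (lookup⇒[]=)
open import Data.Product using (∃₂; _,_; proj₁; proj₂; uncurry)
open import Data.Sum using (_⊎_; inj₁; inj₂)
open import Data.Unit using (⊤; tt)
open import Function using (_∘_; id)
open import Function.Definitions using (Injective; Bijective)
open import Relation.Binary.Definitions using (tri<; tri≈; tri>)
open import Relation.Binary.PropositionalEquality hiding ([_])
open import Relation.Nullary using (¬_; Dec; yes; no; does; contradiction)
open import Relation.Nullary.Decidable using (_×-dec_)

-- Two permutations are needed at a point because addition alone may be structured: if `X` and `Y`
-- leave the same subgroup as traces there, the sums fill only that subgroup, and a random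
-- relabelling `σ` of the symbols can still miss a small `Z` easily. A random `τ` spreads the sums
-- over about min(m, x y) values; `σ` then has to keep all of them off `Z`. A constant saving at a
-- constant fraction of the p² points beats 16⁻ⁿ once n = m p is a small enough multiple of p². A
-- narrow box touches too few points for that, so its saving per point must grow with y z / m. All
-- probabilities are cleared of denominators and become inequalities between counts of pairs (τ ,
-- σ). Constants: (3/4)^12 ≤ 1/16 and a quarter of the points give 48 = 4 · 12; 96 bounds p / m
-- after rounding. C = 272 · 96 comes from the narrow case: it forces |X||Y| ≥ 272 p², so that the
-- points where y is below half its mean number at most p|X|/68, a quarter of the guaranteed p|X|/17
-- touched points.

private
  variable
    A B K : Set
    m n : ℕ

-- Finite sums

∑ : List A → (A → ℕ) → ℕ
∑ []       f = 0
∑ (x ∷ xs) f = f x + ∑ xs f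

∑-mono : ∀ (xs : List A) {f g} → (∀ x → f x ≤ g x) → ∑ xs f ≤ ∑ xs g
∑-mono []       f≤g = z≤n
∑-mono (x ∷ xs) f≤g = +-mono-≤ (f≤g x) (∑-mono xs f≤g)

∑-cong : ∀ (xs : List A) {f g} → (∀ x → f x ≡ g x) → ∑ xs f ≡ ∑ xs g
∑-cong []       f≡g = refl
∑-cong (x ∷ xs) f≡g = cong₂ _+_ (f≡g x) (∑-cong xs f≡g)

∑-+ : ∀ (xs : List A) f g → ∑ xs (λ x → f x + g x) ≡ ∑ xs f + ∑ xs g
∑-+ []       f g = refl
∑-+ (x ∷ xs) f g = trans (cong (f x + g x +_) (∑-+ xs f g)) (swap (f x) (g x) _ _)
  where
  swap : ∀ a b c d → (a + b) + (c + d) ≡ (a + c) + (b + d)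
  swap = solve-∀

∑-*ˡ : ∀ (xs : List A) c f → ∑ xs (λ x → c * f x) ≡ c * ∑ xs f
∑-*ˡ []       c f = sym (*-zeroʳ c)
∑-*ˡ (x ∷ xs) c f = trans (cong (c * f x +_) (∑-*ˡ xs c f)) (sym (*-distribˡ-+ c (f x) _))

∑-*ʳ : ∀ (xs : List A) f c → ∑ xs (λ x → f x * c) ≡ ∑ xs f * c
∑-*ʳ xs f c = trans (∑-cong xs λ x → *-comm (f x) c) (trans (∑-*ˡ xs c f) (*-comm c _))

∑-const : ∀ (xs : List A) c → ∑ xs (λ _ → c) ≡ length xs * c
∑-const []       c = refl
∑-const (x ∷ xs) c = cong (c +_) (∑-const xs c)

∑-comm : ∀ (xs : List A) (ys : List B) (f : A → B → ℕ) →
         ∑ xs (λ x → ∑ ys (f x)) ≡ ∑ ys (λ y → ∑ xs λ x → f x y)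
∑-comm []       ys f = sym (trans (∑-const ys 0) (*-zeroʳ (length ys)))
∑-comm (x ∷ xs) ys f = trans (cong (∑ ys (f x) +_) (∑-comm xs ys f)) (sym (∑-+ ys (f x) _))

∑-++ : ∀ (xs ys : List A) f → ∑ (xs ++ ys) f ≡ ∑ xs f + ∑ ys f
∑-++ []       ys f = refl
∑-++ (x ∷ xs) ys f = trans (cong (f x +_) (∑-++ xs ys f)) (sym (+-assoc (f x) _ _))

∑-map : ∀ (h : A → B) xs f → ∑ (map h xs) f ≡ ∑ xs (f ∘ h)
∑-map h []       f = refl
∑-map h (x ∷ xs) f = cong (f (h x) +_) (∑-map h xs f)

∑-product : ∀ (xs : List A) (ys : List B) f →
            ∑ (cartesianProduct xs ys) f ≡ ∑ xs (λ x → ∑ ys λ y → f (x , y))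
∑-product []       ys f = refl
∑-product (x ∷ xs) ys f =
  trans (∑-++ (map (x ,_) ys) _ f) (cong₂ _+_ (∑-map (x ,_) ys f) (∑-product xs ys f))

∑-∈ : ∀ {xs : List A} f {x} → x ∈ xs → f x ≤ ∑ xs f
∑-∈ f (here refl) = m≤m+n _ _
∑-∈ f {x} (there {y} x∈xs) = ≤-trans (∑-∈ f x∈xs) (m≤n+m _ (f y))

∑-pigeonhole : ∀ (xs : List A) f c → ∑ xs f < length xs * c → ∃ λ x → f x < c
∑-pigeonhole (x ∷ xs) f c lt with suc (f x) ≤? c
... | yes fx<c = x , fx<c
... | no  fx≮c = ∑-pigeonhole xs f c
  (+-cancelˡ-< c _ _ (≤-<-trans (+-monoˡ-≤ (∑ xs f) (≮⇒≥ fx≮c)) lt))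

∑ᶠ : ∀ n → (Fin n → ℕ) → ℕ
∑ᶠ n = ∑ (allFin n)

∑-tabulate : ∀ (g : Fin n → A) f → ∑ (tabulate g) f ≡ ∑ᶠ n (f ∘ g)
∑-tabulate {n = zero}  g f = refl
∑-tabulate {n = suc n} g f = cong (f (g zero) +_)
  (trans (∑-tabulate (g ∘ suc) f) (sym (∑-tabulate suc (f ∘ g))))

∑ᶠ-suc : ∀ (f : Fin (suc n) → ℕ) → ∑ᶠ (suc n) f ≡ f zero + ∑ᶠ n (f ∘ suc)
∑ᶠ-suc f = cong (f zero +_) (∑-tabulate suc f)

∑ᶠ-const : ∀ n c → ∑ᶠ n (λ _ → c) ≡ n * c
∑ᶠ-const n c = trans (∑-const (allFin n) c) (cong (_* c) (length-tabulate {n = n} id))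

∑ᶠ-punchIn : ∀ i (f : Fin (suc n) → ℕ) → ∑ᶠ (suc n) f ≡ f i + ∑ᶠ n (f ∘ punchIn i)
∑ᶠ-punchIn zero f = ∑ᶠ-suc f
∑ᶠ-punchIn {n = suc n} (suc i) f = begin
  ∑ᶠ (suc (suc n)) f                                           ≡⟨ ∑ᶠ-suc f ⟩
  f zero + ∑ᶠ (suc n) (f ∘ suc)                                ≡⟨ cong (f zero +_) (∑ᶠ-punchIn i (f ∘ suc)) ⟩
  f zero + (f (suc i) + ∑ᶠ n (f ∘ suc ∘ punchIn i))            ≡⟨ rotate (f zero) (f (suc i)) _ ⟩
  f (suc i) + (f zero + ∑ᶠ n (f ∘ punchIn (suc i) ∘ suc))      ≡⟨ cong (f (suc i) +_) (∑ᶠ-suc (f ∘ punchIn (suc i))) ⟨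
  f (suc i) + ∑ᶠ (suc n) (f ∘ punchIn (suc i))                 ∎
  where
  open ≡-Reasoning
  rotate : ∀ a b c → a + (b + c) ≡ b + (a + c)
  rotate = solve-∀

-- Induction on `m`: deleting the value `φ zero` from the codomain and relabelling by `punchOut`
-- leaves an injection between smaller sets.
∑ᶠ-injective-≤ : ∀ (φ : Fin m → Fin n) → Injective _≡_ _≡_ φ → ∀ f → ∑ᶠ m (f ∘ φ) ≤ ∑ᶠ n f
∑ᶠ-injective-≤ {zero}            φ φ-inj f = z≤n
∑ᶠ-injective-≤ {suc m} {zero}    φ φ-inj f with () ← φ zero
∑ᶠ-injective-≤ {suc m} {suc n} φ φ-inj f = begin
  ∑ᶠ (suc m) (f ∘ φ)                              ≡⟨ ∑ᶠ-suc (f ∘ φ) ⟩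
  f (φ zero) + ∑ᶠ m (f ∘ φ ∘ suc)                 ≡⟨ cong (f (φ zero) +_) (∑-cong (allFin m) λ i → cong f (punchIn-punchOut (φ0≢ i))) ⟨
  f (φ zero) + ∑ᶠ m (f ∘ punchIn (φ zero) ∘ ψ)    ≤⟨ +-monoʳ-≤ (f (φ zero)) (∑ᶠ-injective-≤ ψ ψ-inj (f ∘ punchIn (φ zero))) ⟩
  f (φ zero) + ∑ᶠ n (f ∘ punchIn (φ zero))        ≡⟨ ∑ᶠ-punchIn (φ zero) f ⟨
  ∑ᶠ (suc n) f                                    ∎
  where
  open ≤-Reasoning
  φ0≢ : ∀ i → φ zero ≢ φ (suc i)
  φ0≢ i eq with () ← φ-inj eq
  ψ : Fin m → Fin n
  ψ i = punchOut (φ0≢ i)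
  ψ-inj : Injective _≡_ _≡_ ψ
  ψ-inj {i} {j} eq = suc-injective (φ-inj (punchOut-injective (φ0≢ i) (φ0≢ j) eq))

injective⇒surjective : ∀ (φ : Fin n → Fin n) → Injective _≡_ _≡_ φ → ∀ j → ∃ λ i → φ i ≡ j
injective⇒surjective {suc n} φ φ-inj j with any? (λ i → φ i ≟ᶠ j)
... | yes hit = hit
... | no  j∉φ = contradiction (injective⇒≤ ψ-inj) (<⇒≱ (n<1+n n))
  where
  j≢ : ∀ i → j ≢ φ i
  j≢ i eq = j∉φ (i , sym eq)
  ψ : Fin (suc n) → Fin n
  ψ i = punchOut (j≢ i)
  ψ-inj : Injective _≡_ _≡_ ψ
  ψ-inj {i} {k} eq = φ-inj (punchOut-injective (j≢ i) (j≢ k) eq)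

injective⇒bijective : ∀ (φ : Fin n → Fin n) → Injective _≡_ _≡_ φ → Bijective _≡_ _≡_ φ
injective⇒bijective φ φ-inj = φ-inj , λ j →
  let i , φi≡j = injective⇒surjective φ φ-inj j in i , λ { refl → φi≡j }

∑ᶠ-injective-≡ : ∀ (φ : Fin n → Fin n) → Injective _≡_ _≡_ φ → ∀ f → ∑ᶠ n (f ∘ φ) ≡ ∑ᶠ n f
∑ᶠ-injective-≡ {n} φ φ-inj f = ≤-antisym (∑ᶠ-injective-≤ φ φ-inj f) (begin
  ∑ᶠ n f              ≡⟨ ∑-cong (allFin n) (λ j → cong f (φψ j)) ⟨
  ∑ᶠ n (f ∘ φ ∘ ψ)    ≤⟨ ∑ᶠ-injective-≤ ψ ψ-inj (f ∘ φ) ⟩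
  ∑ᶠ n (f ∘ φ)        ∎)
  where
  open ≤-Reasoning
  ψ : Fin n → Fin n
  ψ j = proj₁ (injective⇒surjective φ φ-inj j)
  φψ : ∀ j → φ (ψ j) ≡ j
  φψ j = proj₂ (injective⇒surjective φ φ-inj j)
  ψ-inj : Injective _≡_ _≡_ ψ
  ψ-inj {j} {k} eq = trans (sym (φψ j)) (trans (cong φ eq) (φψ k))

-- Counting with Boolean predicates

⟦_⟧ : Bool → ℕ
⟦ true ⟧  = 1
⟦ false ⟧ = 0

⟦⟧≤1 : ∀ b → ⟦ b ⟧ ≤ 1
⟦⟧≤1 true  = ≤-refl
⟦⟧≤1 false = z≤n

count : (Fin n → Bool) → ℕ
count {n} P = ∑ᶠ n (⟦_⟧ ∘ P)

count-not : ∀ (P : Fin n → Bool) → count P + count (not ∘ P) ≡ n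
count-not {n} P = begin
  count P + count (not ∘ P)                   ≡⟨ ∑-+ (allFin n) _ _ ⟨
  ∑ᶠ n (λ i → ⟦ P i ⟧ + ⟦ not (P i) ⟧)        ≡⟨ ∑-cong (allFin n) (λ i → lem (P i)) ⟩
  ∑ᶠ n (λ _ → 1)                              ≡⟨ ∑ᶠ-const n 1 ⟩
  n * 1                                       ≡⟨ *-identityʳ n ⟩
  n                                           ∎
  where
  open ≡-Reasoning
  lem : ∀ b → ⟦ b ⟧ + ⟦ not b ⟧ ≡ 1
  lem true  = refl
  lem false = refl

count≤n : ∀ (P : Fin n → Bool) → count P ≤ n
count≤n {n} P = subst (count P ≤_) (count-not P) (m≤m+n _ _)

count>0 : ∀ (P : Fin n → Bool) → 0 < count P → ∃ λ i → P i ≡ true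
count>0 {suc n} P 0<P with P zero in eq
... | true  = zero , eq
... | false with i , Pi ← count>0 (P ∘ suc) (subst (0 <_) (∑-tabulate suc (⟦_⟧ ∘ P)) 0<P) = suc i , Pi

∑-indicator : ∀ (j : Fin n) → ∑ᶠ n (λ k → ⟦ does (j ≟ᶠ k) ⟧) ≤ 1
∑-indicator {suc n} j = begin
  ∑ᶠ (suc n) (λ k → ⟦ does (j ≟ᶠ k) ⟧)                              ≡⟨ ∑ᶠ-punchIn j _ ⟩
  ⟦ does (j ≟ᶠ j) ⟧ + ∑ᶠ n (λ k → ⟦ does (j ≟ᶠ punchIn j k) ⟧)      ≡⟨ cong (⟦ does (j ≟ᶠ j) ⟧ +_) (∑-cong (allFin n) off) ⟩
  ⟦ does (j ≟ᶠ j) ⟧ + ∑ᶠ n (λ _ → 0)                                ≡⟨ cong (⟦ does (j ≟ᶠ j) ⟧ +_) (trans (∑ᶠ-const n 0) (*-zeroʳ n)) ⟩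
  ⟦ does (j ≟ᶠ j) ⟧ + 0                                             ≡⟨ +-identityʳ _ ⟩
  ⟦ does (j ≟ᶠ j) ⟧                                                 ≤⟨ ⟦⟧≤1 _ ⟩
  1                                                                 ∎
  where
  open ≤-Reasoning
  off : ∀ k → ⟦ does (j ≟ᶠ punchIn j k) ⟧ ≡ 0
  off k with j ≟ᶠ punchIn j k
  ... | yes eq = contradiction (sym eq) (punchInᵢ≢i j k)
  ... | no  _  = refl

-- Permutations mapping one set into another

-- The pair (i , π) is the permutation with 0 ↦ i that acts as π, relabelled
-- by punchIn i, on the remaining points.
Perm : ℕ → Set
Perm zero    = ⊤
Perm (suc n) = Fin (suc n) × Perm n

act : Perm n → Fin n → Fin n
act {suc n} (i , π) zero    = i
act {suc n} (i , π) (suc k) = punchIn i (act π k)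

act-injective : ∀ (π : Perm n) → Injective _≡_ _≡_ (act π)
act-injective {suc n} (i , π) {zero}  {zero}  eq = refl
act-injective {suc n} (i , π) {zero}  {suc l} eq = contradiction (sym eq) (punchInᵢ≢i i _)
act-injective {suc n} (i , π) {suc k} {zero}  eq = contradiction eq (punchInᵢ≢i i _)
act-injective {suc n} (i , π) {suc k} {suc l} eq =
  cong suc (act-injective π (punchIn-injective i _ _ eq))

perms : ∀ n → List (Perm n)
perms zero    = tt ∷ []
perms (suc n) = cartesianProduct (allFin (suc n)) (perms n)

∑-perms : ∀ n (f : Perm (suc n) → ℕ) →
          ∑ (perms (suc n)) f ≡ ∑ᶠ (suc n) (λ i → ∑ (perms n) λ π → f (i , π))
∑-perms n f = ∑-product (allFin (suc n)) (perms n) f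

length-perms : ∀ n → length (perms n) ≡ n !
length-perms n = trans (sym (trans (∑-const (perms n) 1) (*-identityʳ _))) (go n)
  where
  go : ∀ n → ∑ (perms n) (λ _ → 1) ≡ n !
  go zero    = refl
  go (suc n) = trans (∑-perms n _)
    (trans (∑-cong (allFin (suc n)) λ _ → go n) (∑ᶠ-const (suc n) (n !)))

-- The indicator that `act π` sends `S` into `W`, written as a product along the encoding of `π`, so
-- that its sum over all permutations can be evaluated by recursion on the image of `zero`.
mapsInto : (S W : Fin n → Bool) → Perm n → ℕ
mapsInto {zero}  S W π       = 1
mapsInto {suc n} S W (i , π) =
  (if S zero then ⟦ W i ⟧ else 1) * mapsInto (S ∘ suc) (W ∘ punchIn i) π

mapsInto-complete : ∀ (S W : Fin n → Bool) π →
                    (∀ k → S k ≡ true → W (act π k) ≡ true) → mapsInto S W π ≡ 1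
mapsInto-complete {zero}  S W π       h = refl
mapsInto-complete {suc n} S W (i , π) h =
  cong₂ _*_ head≡1 (mapsInto-complete (S ∘ suc) (W ∘ punchIn i) π (h ∘ suc))
  where
  head≡1 : (if S zero then ⟦ W i ⟧ else 1) ≡ 1
  head≡1 with S zero in eq
  ... | true  = cong ⟦_⟧ (h zero eq)
  ... | false = refl

-- Falling factorials

infix 8 _↓_
_↓_ : ℕ → ℕ → ℕ
w     ↓ zero  = 1
zero  ↓ suc s = 0
suc w ↓ suc s = suc w * (w ↓ s)

↓-last : ∀ w s → w ↓ suc s ≡ (w ↓ s) * (w ∸ s)
↓-last zero    zero    = refl
↓-last zero    (suc s) = refl
↓-last (suc w) zero    = trans (*-identityʳ (suc w)) (sym (*-identityˡ (suc w)))
↓-last (suc w) (suc s) = trans (cong (suc w *_) (↓-last w s)) (sym (*-assoc (suc w) (w ↓ s) (w ∸ s)))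

-- Double count of pairs of an injection from an s-set into a set of `suc w` values and one such
-- value. The value is either avoided, leaving `w ↓ s` injections, or is one of the `s` values that
-- the injection takes.
↓-pred : ∀ w s → suc w * (w ↓ s) + s * (suc w ↓ s) ≡ suc w * (suc w ↓ s)
↓-pred w zero    = +-identityʳ _
↓-pred w (suc s) = begin
  suc w * (w ↓ suc s) + suc s * (suc w * (w ↓ s))        ≡⟨ cong (λ a → suc w * a + suc s * (suc w * (w ↓ s))) (↓-last w s) ⟩
  suc w * ((w ↓ s) * (w ∸ s)) + suc s * (suc w * (w ↓ s)) ≡⟨ lem (suc w) (w ↓ s) (w ∸ s) (suc s) ⟩
  suc w * ((w ↓ s) * ((w ∸ s) + suc s))                  ≡⟨ cong (suc w *_) (tail (≤-total s w)) ⟩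
  suc w * (suc w * (w ↓ s))                              ∎
  where
  open ≡-Reasoning
  lem : ∀ a p d s → a * (p * d) + s * (a * p) ≡ a * (p * (d + s))
  lem = solve-∀
  ↓-zero : ∀ {w s} → w < s → w ↓ s ≡ 0
  ↓-zero {zero}  {suc s} _         = refl
  ↓-zero {suc w} {suc s} (s≤s w<s) = trans (cong (suc w *_) (↓-zero w<s)) (*-zeroʳ (suc w))
  tail : s ≤ w ⊎ w ≤ s → (w ↓ s) * ((w ∸ s) + suc s) ≡ suc w * (w ↓ s)
  tail (inj₁ s≤w) = trans (cong ((w ↓ s) *_) (trans (+-suc (w ∸ s) s) (cong suc (m∸n+n≡m s≤w)))) (*-comm (w ↓ s) (suc w))
  tail (inj₂ w≤s) with m≤n⇒m<n∨m≡n w≤s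
  ... | inj₁ w<s  rewrite ↓-zero w<s = sym (*-zeroʳ w)
  ... | inj₂ refl rewrite n∸n≡0 w = *-comm (w ↓ w) (suc w)

private
  -- For a point outside `S`: its image is one of `w` values in `W`, leaving `Q` ways to continue,
  -- or one of `w′` values outside, leaving `P` ways.
  mean-identity : ∀ w w′ s d P Q → w * Q + s * P ≡ w * P → w + w′ ≡ s + d →
                  w * Q + w′ * P ≡ d * P
  mean-identity w w′ s d P Q eq eq′ = +-cancelˡ-≡ (s * P) _ _ (begin
    s * P + (w * Q + w′ * P)    ≡⟨ l₁ (s * P) (w * Q) (w′ * P) ⟩
    (w * Q + s * P) + w′ * P    ≡⟨ cong (_+ w′ * P) eq ⟩
    w * P + w′ * P              ≡⟨ *-distribʳ-+ P w w′ ⟨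
    (w + w′) * P                ≡⟨ cong (_* P) eq′ ⟩
    (s + d) * P                 ≡⟨ *-distribʳ-+ P s d ⟩
    s * P + d * P               ∎)
    where
    open ≡-Reasoning
    l₁ : ∀ a b c → a + (b + c) ≡ (b + a) + c
    l₁ = solve-∀

∑-split : ∀ (W : Fin n → Bool) (F : Fin n → ℕ) a b →
          (∀ i → W i ≡ true → F i ≡ a) → (∀ i → W i ≡ false → F i ≡ b) →
          ∑ᶠ n F ≡ count W * a + count (not ∘ W) * b
∑-split {n} W F a b Fa Fb = begin
  ∑ᶠ n F                                                  ≡⟨ ∑-cong (allFin n) pointwise ⟩
  ∑ᶠ n (λ i → ⟦ W i ⟧ * a + ⟦ not (W i) ⟧ * b)            ≡⟨ ∑-+ (allFin n) _ _ ⟩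
  ∑ᶠ n (λ i → ⟦ W i ⟧ * a) + ∑ᶠ n (λ i → ⟦ not (W i) ⟧ * b)
    ≡⟨ cong₂ _+_ (∑-*ʳ (allFin n) _ a) (∑-*ʳ (allFin n) _ b) ⟩
  count W * a + count (not ∘ W) * b                       ∎
  where
  open ≡-Reasoning
  pointwise : ∀ i → F i ≡ ⟦ W i ⟧ * a + ⟦ not (W i) ⟧ * b
  pointwise i with W i in eq
  ... | true  = trans (Fa i eq) (sym (trans (+-identityʳ _) (*-identityˡ a)))
  ... | false = trans (Fb i eq) (sym (*-identityˡ b))

-- Place `S` injectively into `W`, then the other points arbitrarily. The induction conditions on
-- the image `i` of `zero`: if `zero` is in `S` only `i` in `W` contribute, otherwise
-- `mean-identity` combines both kinds of `i`.
∑-mapsInto : ∀ (S W : Fin n → Bool) →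
             ∑ (perms n) (mapsInto S W) ≡ (count W ↓ count S) * (count (not ∘ S)) !
∑-mapsInto {zero}  S W = refl
∑-mapsInto {suc n} S W = begin
  ∑ (perms (suc n)) (mapsInto S W)
    ≡⟨ ∑-perms n (mapsInto S W) ⟩
  ∑ᶠ (suc n) (λ i → ∑ (perms n) λ π → h i * mapsInto (S ∘ suc) (W ∘ punchIn i) π)
    ≡⟨ ∑-cong (allFin (suc n)) (λ i → trans (∑-*ˡ (perms n) (h i) _) (cong (h i *_) (∑-mapsInto (S ∘ suc) (W ∘ punchIn i)))) ⟩
  ∑ᶠ (suc n) (λ i → h i * ((count (W ∘ punchIn i) ↓ count (S ∘ suc)) * count (not ∘ S ∘ suc) !))
    ≡⟨ step (S zero) refl ⟩
  (count W ↓ count S) * (count (not ∘ S)) ! ∎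
  where
  open ≡-Reasoning
  h : Fin (suc n) → ℕ
  h i = if S zero then ⟦ W i ⟧ else 1
  s₁ d₁ : ℕ
  s₁ = count (S ∘ suc)
  d₁ = count (not ∘ S ∘ suc)
  term : Bool → Fin (suc n) → ℕ
  term b i = (if b then ⟦ W i ⟧ else 1) * ((count (W ∘ punchIn i) ↓ s₁) * d₁ !)
  in-W : ∀ i → W i ≡ true → count W ≡ suc (count (W ∘ punchIn i))
  in-W i eq = trans (∑ᶠ-punchIn i (⟦_⟧ ∘ W)) (cong (λ b → ⟦ b ⟧ + count (W ∘ punchIn i)) eq)
  out-W : ∀ i → W i ≡ false → count W ≡ count (W ∘ punchIn i)
  out-W i eq = trans (∑ᶠ-punchIn i (⟦_⟧ ∘ W)) (cong (λ b → ⟦ b ⟧ + count (W ∘ punchIn i)) eq)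
  countS : count S ≡ ⟦ S zero ⟧ + s₁
  countS = ∑ᶠ-suc (⟦_⟧ ∘ S)
  countS′ : count (not ∘ S) ≡ ⟦ not (S zero) ⟧ + d₁
  countS′ = ∑ᶠ-suc (⟦_⟧ ∘ not ∘ S)
  -- `pred w` is the size of `W` once one of its values is used up. For `w` equal to zero it is a
  -- default that is multiplied by zero.
  one-in : ∀ w → w * ((pred w ↓ s₁) * d₁ !) + count (not ∘ W) * 0 ≡ (w ↓ suc s₁) * d₁ !
  one-in zero    = *-zeroʳ (count (not ∘ W))
  one-in (suc w) = trans (cong (suc w * ((w ↓ s₁) * d₁ !) +_) (*-zeroʳ (count (not ∘ W))))
    (trans (+-identityʳ _) (sym (*-assoc (suc w) (w ↓ s₁) (d₁ !))))
  ↓-pred′ : ∀ w → w * (pred w ↓ s₁) + s₁ * (w ↓ s₁) ≡ w * (w ↓ s₁)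
  ↓-pred′ zero    = lem s₁
    where
    lem : ∀ s → s * (0 ↓ s) ≡ 0
    lem zero    = refl
    lem (suc s) = *-zeroʳ s
  ↓-pred′ (suc w) = ↓-pred w s₁
  total : count W + count (not ∘ W) ≡ s₁ + suc d₁
  total = trans (count-not W) (sym (trans (+-suc s₁ d₁) (cong suc (count-not (S ∘ suc)))))
  step : ∀ b → S zero ≡ b → ∑ᶠ (suc n) (term (S zero)) ≡ (count W ↓ count S) * (count (not ∘ S)) !
  step true eq rewrite countS | countS′ | eq = trans
    (∑-split W (term true) ((pred (count W) ↓ s₁) * d₁ !) 0
      (λ i Wi → trans (cong (λ b → ⟦ b ⟧ * ((count (W ∘ punchIn i) ↓ s₁) * d₁ !)) Wi) (trans (*-identityˡ _)
        (cong (λ w → (pred w ↓ s₁) * d₁ !) (sym (in-W i Wi)))))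
      (λ i Wi → cong (λ b → ⟦ b ⟧ * ((count (W ∘ punchIn i) ↓ s₁) * d₁ !)) Wi))
    (one-in (count W))
  step false eq rewrite countS | countS′ | eq = begin
    ∑ᶠ (suc n) (term false)
      ≡⟨ ∑-split W (term false) ((pred (count W) ↓ s₁) * d₁ !) ((count W ↓ s₁) * d₁ !)
         (λ i Wi → trans (*-identityˡ _) (cong (λ w → (pred w ↓ s₁) * d₁ !) (sym (in-W i Wi))))
         (λ i Wi → trans (*-identityˡ _) (cong (λ w → (w ↓ s₁) * d₁ !) (sym (out-W i Wi)))) ⟩
    count W * ((pred (count W) ↓ s₁) * d₁ !) + count (not ∘ W) * ((count W ↓ s₁) * d₁ !)
      ≡⟨ factor (count W) (pred (count W) ↓ s₁) (count (not ∘ W)) (count W ↓ s₁) (d₁ !) ⟩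
    (count W * (pred (count W) ↓ s₁) + count (not ∘ W) * (count W ↓ s₁)) * d₁ !
      ≡⟨ cong (_* d₁ !) (mean-identity (count W) (count (not ∘ W)) s₁ (suc d₁) _ _ (↓-pred′ (count W)) total) ⟩
    suc d₁ * (count W ↓ s₁) * d₁ !
      ≡⟨ trans (cong (_* d₁ !) (*-comm (suc d₁) (count W ↓ s₁))) (*-assoc (count W ↓ s₁) (suc d₁) (d₁ !)) ⟩
    (count W ↓ s₁) * (suc d₁ * d₁ !) ∎
    where
    factor : ∀ a b c d e → a * (b * e) + c * (d * e) ≡ (a * b + c * d) * e
    factor = solve-∀

-- Drawing without replacement is no worse than with replacement: after s points have landed in `W`,
-- the next does so with probability (w - s)/(m - s), at most w/m because `w ≤ m`. This comparison
-- is `shrink`, where `suc d` stands for m - s.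
↓-bound : ∀ {m} w s d → w ≤ m → s + d ≡ m → (w ↓ s) * d ! * m ^ s ≤ w ^ s * m !
↓-bound w zero    d w≤m refl = ≤-reflexive (*-identityʳ _)
↓-bound {m} w (suc s) d w≤m eq = begin
  (w ↓ suc s) * d ! * m ^ suc s                ≡⟨ cong (λ a → a * d ! * m ^ suc s) (↓-last w s) ⟩
  (w ↓ s) * (w ∸ s) * d ! * (m * m ^ s)        ≡⟨ l₁ (w ↓ s) (w ∸ s) (d !) m (m ^ s) ⟩
  (w ↓ s) * d ! * m ^ s * ((w ∸ s) * m)        ≤⟨ *-monoʳ-≤ ((w ↓ s) * d ! * m ^ s) shrink ⟩
  (w ↓ s) * d ! * m ^ s * (w * suc d)          ≡⟨ l₂ (w ↓ s) (d !) (m ^ s) w (suc d) ⟩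
  w * ((w ↓ s) * (suc d * d !) * m ^ s)        ≤⟨ *-monoʳ-≤ w (↓-bound w s (suc d) w≤m (trans (+-suc s d) eq)) ⟩
  w * (w ^ s * m !)                            ≡⟨ *-assoc w (w ^ s) (m !) ⟨
  w ^ suc s * m !                              ∎
  where
  open ≤-Reasoning
  l₁ : ∀ a b c d e → a * b * c * (d * e) ≡ a * c * e * (b * d)
  l₁ = solve-∀
  l₂ : ∀ a b c d e → a * b * c * (d * e) ≡ d * (a * (e * b) * c)
  l₂ = solve-∀
  shrink : (w ∸ s) * m ≤ w * suc d
  shrink = ≤-trans (≤-reflexive (*-distribʳ-∸ m w s)) (m≤n+o⇒m∸n≤o (w * m) (s * m) (begin
    w * m                    ≡⟨ cong (w *_) (trans (sym eq) (sym (+-suc s d))) ⟩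
    w * (s + suc d)          ≡⟨ *-distribˡ-+ w s (suc d) ⟩
    w * s + w * suc d        ≤⟨ +-monoˡ-≤ (w * suc d) (≤-trans (*-monoˡ-≤ s w≤m) (≤-reflexive (*-comm m s))) ⟩
    s * m + w * suc d        ∎))

∑-mapsInto-bound : ∀ {m} (S W : Fin m → Bool) →
                   ∑ (perms m) (mapsInto S W) * m ^ count S ≤ count W ^ count S * m !
∑-mapsInto-bound {m} S W = ≤-trans
  (≤-reflexive (cong (_* m ^ count S) (∑-mapsInto S W)))
  (↓-bound (count W) (count S) (count (not ∘ S)) (count≤n W) (count-not S))

-- A randomly scrambled quasigroup avoiding a box

-- With t = z/m this is (1 - t)^s (1 + s t) ≤ 1. The induction step is (1 - t)(1 + s t + t) ≤ 1 + s
-- t.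
bernoulli : ∀ {m} w z s → w + z ≡ m → w ^ s * (m + s * z) ≤ m ^ s * m
bernoulli w z zero    refl = ≤-reflexive (lem (w + z))
  where
  lem : ∀ a → 1 * (a + 0) ≡ 1 * a
  lem = solve-∀
bernoulli {m} w z (suc s) refl = begin
  w * w ^ s * (m + (z + s * z))   ≤⟨ ≤-trans (m≤m+n _ (w ^ s * (z * z + s * z * z))) (≤-reflexive (lem w z (s * z) s (w ^ s))) ⟩
  w ^ s * (m + s * z) * m         ≤⟨ *-monoˡ-≤ m (bernoulli w z s refl) ⟩
  m ^ s * m * m                   ≡⟨ cong (_* m) (*-comm (m ^ s) m) ⟩
  m ^ suc s * m                   ∎
  where
  open ≤-Reasoning
  lem : ∀ w z t s p → w * p * (w + z + (z + t)) + p * (z * z + t * z) ≡ p * (w + z + t) * (w + z)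
  lem = solve-∀

-- A discrete replacement for (1 - z/m)^s ≤ exp(-s z/m): once j z ≥ m, Bernoulli makes the j-th
-- power of w/m at most 1/2, and `s` contains `g` disjoint blocks of `j` factors.
power-halving : ∀ {m} .{{_ : NonZero m}} w z s g j → w + z ≡ m → m ≤ j * z → g * j ≤ s →
                w ^ s * 2 ^ g ≤ m ^ s
power-halving {m} w z s zero j eq m≤jz _ = begin
  w ^ s * 1   ≡⟨ *-identityʳ _ ⟩
  w ^ s       ≤⟨ ^-monoˡ-≤ s (subst (w ≤_) eq (m≤m+n w z)) ⟩
  m ^ s       ∎
  where open ≤-Reasoning
power-halving {m} w z s (suc g) j eq m≤jz gj≤s with r , refl ← m≤n⇒∃[o]m+o≡n (m+n≤o⇒m≤o j gj≤s) = begin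
  w ^ (j + r) * (2 * 2 ^ g)        ≡⟨ cong (_* (2 * 2 ^ g)) (^-distribˡ-+-* w j r) ⟩
  w ^ j * w ^ r * (2 * 2 ^ g)      ≡⟨ lem (w ^ j) (w ^ r) (2 ^ g) ⟩
  w ^ j * 2 * (w ^ r * 2 ^ g)      ≤⟨ *-mono-≤ half (power-halving w z r g j eq m≤jz (+-cancelˡ-≤ j _ _ gj≤s)) ⟩
  m ^ j * m ^ r                    ≡⟨ ^-distribˡ-+-* m j r ⟨
  m ^ (j + r)                      ∎
  where
  open ≤-Reasoning
  lem : ∀ a b c → a * b * (2 * c) ≡ a * 2 * (b * c)
  lem = solve-∀
  lem₂ : ∀ a b → a * 2 * b ≡ a * (b + b)
  lem₂ = solve-∀
  half : w ^ j * 2 ≤ m ^ j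
  half = *-cancelʳ-≤ _ _ m (begin
    w ^ j * 2 * m          ≡⟨ lem₂ (w ^ j) m ⟩
    w ^ j * (m + m)        ≤⟨ *-monoʳ-≤ (w ^ j) (+-monoʳ-≤ m m≤jz) ⟩
    w ^ j * (m + j * z)    ≤⟨ bernoulli w z j eq ⟩
    m ^ j * m              ∎)

count-mono : ∀ {P Q : Fin n → Bool} → (∀ i → P i ≡ true → Q i ≡ true) → count P ≤ count Q
count-mono {n} {P} {Q} P⊆Q = ∑-mono (allFin n) pointwise
  where
  pointwise : ∀ i → ⟦ P i ⟧ ≤ ⟦ Q i ⟧
  pointwise i with P i in eq
  ... | true  = ≤-reflexive (cong ⟦_⟧ (sym (P⊆Q i eq)))
  ... | false = z≤n

does-true : ∀ {P : Set} (P? : Dec P) → P → does P? ≡ true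
does-true (yes _) _ = refl
does-true (no ¬p) p = contradiction p ¬p

true-does : ∀ {P : Set} (P? : Dec P) → does P? ≡ true → P
true-does (yes p) _ = p

false-does : ∀ {P : Set} (P? : Dec P) → does P? ≡ false → ¬ P
false-does (no ¬p) _ = ¬p

image? : ∀ (f : Fin m → Fin n) (P : Fin m → Bool) k → Dec (∃ λ i → P i ≡ true × f i ≡ k)
image? f P k = any? λ i → (P i ≟ᵇ true) ×-dec (f i ≟ᶠ k)

image : (Fin m → Fin n) → (Fin m → Bool) → Fin n → Bool
image f P k = does (image? f P k)

count-image : ∀ {f : Fin m → Fin n} → Injective _≡_ _≡_ f → ∀ P → count P ≤ count (image f P)
count-image {m = m} {f = f} f-inj P = ≤-trans
  (count-mono λ i Pi → does-true (image? f P (f i)) (i , Pi , refl))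
  (∑ᶠ-injective-≤ f f-inj (⟦_⟧ ∘ image f P))

count-not-≤ : ∀ (P : Fin m → Bool) (Q : Fin m → Bool) → count P ≤ count Q →
              count (not ∘ Q) ≤ count (not ∘ P)
count-not-≤ {m} P Q P≤Q = +-cancelˡ-≤ (count P) _ _ (begin
  count P + count (not ∘ Q)   ≤⟨ +-monoˡ-≤ _ P≤Q ⟩
  count Q + count (not ∘ Q)   ≡⟨ trans (count-not Q) (sym (count-not P)) ⟩
  count P + count (not ∘ P)   ∎)
  where open ≤-Reasoning

-- The slack in `s` and `w` is there because `S` and `W` will depend on the other permutation, while
-- one bound must serve all of its values. Dropping the `r` surplus factors w/m is harmless as
-- `w ≤ m`.
mapsInto-bound : ∀ {m} .{{_ : NonZero m}} (S W : Fin m → Bool) s w → s ≤ count S → count W ≤ w → w ≤ m →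
                 ∑ (perms m) (mapsInto S W) * m ^ s ≤ w ^ s * m !
mapsInto-bound {m} S W s w s≤S W≤w w≤m with r , s+r≡ ← m≤n⇒∃[o]m+o≡n s≤S =
  *-cancelʳ-≤ _ _ (m ^ r) {{m^n≢0 m r}} (begin
    N * m ^ s * m ^ r            ≡⟨ trans (*-assoc N (m ^ s) (m ^ r)) (cong (N *_) (sym (^-distribˡ-+-* m s r))) ⟩
    N * m ^ (s + r)              ≡⟨ cong (λ a → N * m ^ a) s+r≡ ⟩
    N * m ^ count S              ≤⟨ ∑-mapsInto-bound S W ⟩
    count W ^ count S * m !      ≤⟨ *-monoˡ-≤ (m !) (^-monoˡ-≤ (count S) W≤w) ⟩
    w ^ count S * m !            ≡⟨ cong (λ a → w ^ a * m !) s+r≡ ⟨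
    w ^ (s + r) * m !            ≡⟨ cong (_* m !) (^-distribˡ-+-* w s r) ⟩
    w ^ s * w ^ r * m !          ≤⟨ *-monoˡ-≤ (m !) (*-monoʳ-≤ (w ^ s) (^-monoˡ-≤ r w≤m)) ⟩
    w ^ s * m ^ r * m !          ≡⟨ lem (w ^ s) (m ^ r) (m !) ⟩
    w ^ s * m ! * m ^ r          ∎)
  where
  open ≤-Reasoning
  N : ℕ
  N = ∑ (perms m) (mapsInto S W)
  lem : ∀ a b c → a * b * c ≡ a * c * b
  lem = solve-∀

mapsInto-bernoulli : ∀ {m} .{{_ : NonZero m}} (S W : Fin m → Bool) s w z →
                     s ≤ count S → count W ≤ w → w + z ≡ m →
                     ∑ (perms m) (mapsInto S W) * (m + s * z) ≤ m * m !
mapsInto-bernoulli {m} S W s w z s≤S W≤w eq = *-cancelʳ-≤ _ _ (m ^ s) {{m^n≢0 m s}} (begin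
  N * (m + s * z) * m ^ s       ≡⟨ lem₁ N (m + s * z) (m ^ s) ⟩
  N * m ^ s * (m + s * z)       ≤⟨ *-monoˡ-≤ (m + s * z) (mapsInto-bound S W s w s≤S W≤w (subst (w ≤_) eq (m≤m+n w z))) ⟩
  w ^ s * m ! * (m + s * z)     ≡⟨ lem₁ (w ^ s) (m !) (m + s * z) ⟩
  w ^ s * (m + s * z) * m !     ≤⟨ *-monoˡ-≤ (m !) (bernoulli w z s eq) ⟩
  m ^ s * m * m !               ≡⟨ lem₂ (m ^ s) m (m !) ⟩
  m * m ! * m ^ s               ∎)
  where
  open ≤-Reasoning
  N : ℕ
  N = ∑ (perms m) (mapsInto S W)
  lem₁ : ∀ a b c → a * b * c ≡ a * c * b
  lem₁ = solve-∀
  lem₂ : ∀ a b c → a * b * c ≡ b * c * a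
  lem₂ = solve-∀

module Scrambled {m : ℕ} .{{m≢0 : NonZero m}} (_⊕_ : Fin m → Fin m → Fin m)
  (⊕-injˡ : ∀ c → Injective _≡_ _≡_ (_⊕ c)) (⊕-injʳ : ∀ a → Injective _≡_ _≡_ (a ⊕_)) where

  Ω : Set
  Ω = Perm m × Perm m

  Ωs : List Ω
  Ωs = cartesianProduct (perms m) (perms m)

  _[_,_] : Ω → Fin m → Fin m → Fin m
  (τ , σ) [ a , c ] = act σ (a ⊕ act τ c)

  []-injˡ : ∀ ω c → Injective _≡_ _≡_ (ω [_, c ])
  []-injˡ (τ , σ) c eq = ⊕-injˡ (act τ c) (act-injective σ eq)

  []-injʳ : ∀ ω a → Injective _≡_ _≡_ (ω [ a ,_])
  []-injʳ (τ , σ) a eq = act-injective τ (⊕-injʳ a (act-injective σ eq))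

  Hit : (X Y Z : Fin m → Bool) → Ω → Set
  Hit X Y Z ω = ∃₂ λ a c → X a ≡ true × Y c ≡ true × Z (ω [ a , c ]) ≡ true

  hit? : ∀ X Y Z ω → Dec (Hit X Y Z ω)
  hit? X Y Z ω = any? λ a → any? λ c → (X a ≟ᵇ true) ×-dec (Y c ≟ᵇ true) ×-dec (Z (ω [ a , c ]) ≟ᵇ true)

  miss : (X Y Z : Fin m → Bool) → Ω → ℕ
  miss X Y Z ω = ⟦ not (does (hit? X Y Z ω)) ⟧

  miss-complete : ∀ X Y Z ω → ¬ Hit X Y Z ω → miss X Y Z ω ≡ 1
  miss-complete X Y Z ω ¬hit with hit? X Y Z ω
  ... | yes hit = contradiction hit ¬hit
  ... | no  _   = refl

  misses : (X Y Z : Fin m → Bool) → ℕ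
  misses X Y Z = ∑ Ωs (miss X Y Z)

  misses-στ : ∀ X Y Z → misses X Y Z ≡ ∑ (perms m) λ τ → ∑ (perms m) λ σ → miss X Y Z (τ , σ)
  misses-στ X Y Z = ∑-product (perms m) (perms m) (miss X Y Z)

  misses-τσ : ∀ X Y Z → misses X Y Z ≡ ∑ (perms m) λ σ → ∑ (perms m) λ τ → miss X Y Z (τ , σ)
  misses-τσ X Y Z = trans (misses-στ X Y Z) (∑-comm (perms m) (perms m) _)

  ∑-perms-≤ : ∀ f c d → (∀ π → f π * c ≤ d) → ∑ (perms m) f * c ≤ m ! * d
  ∑-perms-≤ f c d f≤ = begin
    ∑ (perms m) f * c                ≡⟨ ∑-*ʳ (perms m) f c ⟨
    ∑ (perms m) (λ π → f π * c)      ≤⟨ ∑-mono (perms m) f≤ ⟩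
    ∑ (perms m) (λ _ → d)            ≡⟨ ∑-const (perms m) d ⟩
    length (perms m) * d             ≡⟨ cong (_* d) (length-perms m) ⟩
    m ! * d                          ∎
    where open ≤-Reasoning

  -- The common shape of all miss estimates: if any point of `S` sent outside `W` would witness `P`,
  -- then failure of `P` forces the permutation to map `S` into `W`.
  ⟦not⟧≤mapsInto : ∀ {P : Set} (P? : Dec P) (S W : Fin m → Bool) π →
                   (∀ k → S k ≡ true → ¬ W (act π k) ≡ true → P) →
                   ⟦ not (does P?) ⟧ ≤ mapsInto S W π
  ⟦not⟧≤mapsInto (yes _) S W π h = z≤n
  ⟦not⟧≤mapsInto (no ¬p) S W π h = ≤-reflexive (sym (mapsInto-complete S W π maps))
    where
    maps : ∀ k → S k ≡ true → W (act π k) ≡ true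
    maps k Sk with W (act π k) in eq
    ... | true  = refl
    ... | false = contradiction (h k Sk λ Wk → contradiction (trans (sym Wk) eq) λ ()) ¬p

  not≢true : ∀ {b} → ¬ not b ≡ true → b ≡ true
  not≢true {true}  _ = refl
  not≢true {false} h = contradiction refl h

  miss-σ : ∀ X Y Z τ σ (S : Fin m → Bool) →
           (∀ k → S k ≡ true → ∃₂ λ a c → X a ≡ true × Y c ≡ true × a ⊕ act τ c ≡ k) →
           miss X Y Z (τ , σ) ≤ mapsInto S (not ∘ Z) σ
  miss-σ X Y Z τ σ S S⊆ = ⟦not⟧≤mapsInto (hit? X Y Z (τ , σ)) S (not ∘ Z) σ λ k Sk Zk →
    let a , c , Xa , Yc , eq = S⊆ k Sk in
    a , c , Xa , Yc , subst (λ j → Z (act σ j) ≡ true) (sym eq) (not≢true Zk)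

  -- Left division in the quasigroup.
  ⊕-solve : Fin m → Fin m → Fin m
  ⊕-solve k a = proj₁ (injective⇒surjective (a ⊕_) (⊕-injʳ a) k)

  ⊕-solves : ∀ k a → a ⊕ ⊕-solve k a ≡ k
  ⊕-solves k a = proj₂ (injective⇒surjective (a ⊕_) (⊕-injʳ a) k)

  ⊕-solve-inj : ∀ k → Injective _≡_ _≡_ (⊕-solve k)
  ⊕-solve-inj k {a} {a′} eq = ⊕-injˡ (⊕-solve k a)
    (trans (⊕-solves k a) (sym (trans (cong (a′ ⊕_) eq) (⊕-solves k a′))))

  w-bound : ∀ (Z : Fin m → Bool) → count (not ∘ Z) ≤ m
  w-bound Z = count≤n (not ∘ Z)

  ∑-misses-bound : ∀ (f : Perm m → Perm m → ℕ) (S W : Perm m → Fin m → Bool) s w → w ≤ m →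
                   (∀ π ρ → f π ρ ≤ mapsInto (S π) (W π) ρ) →
                   (∀ π → s ≤ count (S π)) → (∀ π → count (W π) ≤ w) →
                   ∑ (perms m) (λ π → ∑ (perms m) (f π)) * m ^ s ≤ w ^ s * (m ! * m !)
  ∑-misses-bound f S W s w w≤m f≤ s≤ ≤w = ≤-trans
    (∑-perms-≤ _ (m ^ s) (w ^ s * m !) λ π → ≤-trans
      (*-monoˡ-≤ (m ^ s) (∑-mono (perms m) (f≤ π)))
      (mapsInto-bound (S π) (W π) s w (s≤ π) (≤w π) w≤m))
    (≤-reflexive (swap (m !) (w ^ s) (m !)))
    where
    swap : ∀ a b c → a * (b * c) ≡ b * (a * c)
    swap = solve-∀

  -- Fix `a` in `X`. For every `τ` the values `a ⊕ act τ c` with `c` in `Y` are distinct, and a miss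
  -- forces `σ` to send all of them outside `Z`.
  misses-X : ∀ X Y Z → 0 < count X →
             misses X Y Z * m ^ count Y ≤ count (not ∘ Z) ^ count Y * (m ! * m !)
  misses-X X Y Z 0<X with a , Xa ← count>0 X 0<X =
    subst (λ s → s * m ^ count Y ≤ count (not ∘ Z) ^ count Y * (m ! * m !)) (sym (misses-στ X Y Z))
      (∑-misses-bound (λ τ σ → miss X Y Z (τ , σ)) (λ τ → image (λ c → a ⊕ act τ c) Y) (λ _ → not ∘ Z) (count Y) (count (not ∘ Z)) (w-bound Z)
        (λ τ σ → miss-σ X Y Z τ σ _ λ k Sk →
          let c , Yc , eq = true-does (image? _ Y k) Sk in a , c , Xa , Yc , eq)
        (λ τ → count-image (λ eq → act-injective τ (⊕-injʳ a eq)) Y)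
        (λ _ → ≤-refl))

  misses-Y : ∀ X Y Z → 0 < count Y →
             misses X Y Z * m ^ count X ≤ count (not ∘ Z) ^ count X * (m ! * m !)
  misses-Y X Y Z 0<Y with c , Yc ← count>0 Y 0<Y =
    subst (λ s → s * m ^ count X ≤ count (not ∘ Z) ^ count X * (m ! * m !)) (sym (misses-στ X Y Z))
      (∑-misses-bound (λ τ σ → miss X Y Z (τ , σ)) (λ τ → image (λ a → a ⊕ act τ c) X) (λ _ → not ∘ Z) (count X) (count (not ∘ Z)) (w-bound Z)
        (λ τ σ → miss-σ X Y Z τ σ _ λ k Sk →
          let a , Xa , eq = true-does (image? _ X k) Sk in a , c , Xa , Yc , eq)
        (λ τ → count-image (⊕-injˡ (act τ c)) X)
        (λ _ → ≤-refl))

  -- Here `σ` is fixed and `τ` supplies the randomness. Let `k σ` be the preimage under `σ` of a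
  -- symbol `e` of `Z`. A miss forbids `τ` to send a point of `Y` to a solution b of a ⊕ b = k with
  -- `a` in `X`; distinct `a` give distinct solutions.
  misses-Z : ∀ X Y Z → 0 < count Z →
             misses X Y Z * m ^ count Y ≤ count (not ∘ X) ^ count Y * (m ! * m !)
  misses-Z X Y Z 0<Z with e , Ze ← count>0 Z 0<Z =
    subst (λ s → s * m ^ count Y ≤ count (not ∘ X) ^ count Y * (m ! * m !)) (sym (misses-τσ X Y Z))
      (∑-misses-bound (λ σ τ → miss X Y Z (τ , σ)) (λ _ → Y) (λ σ → not ∘ image (⊕-solve (k σ)) X) (count Y) (count (not ∘ X)) (w-bound X)
        (λ σ τ → ⟦not⟧≤mapsInto (hit? X Y Z (τ , σ)) Y _ τ λ c Yc Wc →
          let a , Xa , eq = true-does (image? (⊕-solve (k σ)) X (act τ c)) (not≢true Wc) in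
          a , c , Xa , Yc , trans (cong (λ j → Z (act σ (a ⊕ j))) (sym eq))
            (trans (cong (Z ∘ act σ) (⊕-solves (k σ) a)) (trans (cong Z (σk σ)) Ze)))
        (λ _ → ≤-refl)
        (λ σ → count-not-≤ X _ (count-image (⊕-solve-inj (k σ)) X)))
    where
    k : Perm m → Fin m
    k σ = proj₁ (injective⇒surjective (act σ) (act-injective σ) e)
    σk : ∀ σ → act σ (k σ) ≡ e
    σk σ = proj₂ (injective⇒surjective (act σ) (act-injective σ) e)

  -- Sumsets under a random relabelling

  Sum : (X Y : Fin m → Bool) → Perm m → Fin m → Set
  Sum X Y τ k = ∃₂ λ a c → X a ≡ true × Y c ≡ true × a ⊕ act τ c ≡ k

  sum? : ∀ X Y τ k → Dec (Sum X Y τ k)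
  sum? X Y τ k = any? λ a → any? λ c → (X a ≟ᵇ true) ×-dec (Y c ≟ᵇ true) ×-dec (a ⊕ act τ c ≟ᶠ k)

  sumset : (X Y : Fin m → Bool) → Perm m → Fin m → Bool
  sumset X Y τ k = does (sum? X Y τ k)

  count-sumset : ∀ X Y τ → count (sumset X Y τ) ≤ count X * count Y
  count-sumset X Y τ = begin
    ∑ᶠ m (λ k → ⟦ sumset X Y τ k ⟧)
      ≤⟨ ∑-mono (allFin m) cover ⟩
    ∑ᶠ m (λ k → ∑ᶠ m λ a → ∑ᶠ m λ c → ⟦ X a ⟧ * (⟦ Y c ⟧ * δ a c k))
      ≡⟨ ∑-comm (allFin m) (allFin m) _ ⟩
    ∑ᶠ m (λ a → ∑ᶠ m λ k → ∑ᶠ m λ c → ⟦ X a ⟧ * (⟦ Y c ⟧ * δ a c k))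
      ≡⟨ ∑-cong (allFin m) (λ a → ∑-comm (allFin m) (allFin m) _) ⟩
    ∑ᶠ m (λ a → ∑ᶠ m λ c → ∑ᶠ m λ k → ⟦ X a ⟧ * (⟦ Y c ⟧ * δ a c k))
      ≤⟨ ∑-mono (allFin m) (λ a → ∑-mono (allFin m) λ c → collapse a c) ⟩
    ∑ᶠ m (λ a → ∑ᶠ m λ c → ⟦ X a ⟧ * ⟦ Y c ⟧)
      ≡⟨ ∑-cong (allFin m) (λ a → ∑-*ˡ (allFin m) ⟦ X a ⟧ _) ⟩
    ∑ᶠ m (λ a → ⟦ X a ⟧ * count Y)
      ≡⟨ ∑-*ʳ (allFin m) _ (count Y) ⟩
    count X * count Y ∎
    where
    open ≤-Reasoning
    δ : Fin m → Fin m → Fin m → ℕ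
    δ a c k = ⟦ does (a ⊕ act τ c ≟ᶠ k) ⟧
    collapse : ∀ a c → ∑ᶠ m (λ k → ⟦ X a ⟧ * (⟦ Y c ⟧ * δ a c k)) ≤ ⟦ X a ⟧ * ⟦ Y c ⟧
    collapse a c = begin
      ∑ᶠ m (λ k → ⟦ X a ⟧ * (⟦ Y c ⟧ * δ a c k))   ≡⟨ trans (∑-*ˡ (allFin m) ⟦ X a ⟧ _) (cong (⟦ X a ⟧ *_) (∑-*ˡ (allFin m) ⟦ Y c ⟧ _)) ⟩
      ⟦ X a ⟧ * (⟦ Y c ⟧ * ∑ᶠ m (δ a c))           ≤⟨ *-monoʳ-≤ ⟦ X a ⟧ (*-monoʳ-≤ ⟦ Y c ⟧ (∑-indicator (a ⊕ act τ c))) ⟩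
      ⟦ X a ⟧ * (⟦ Y c ⟧ * 1)                      ≡⟨ cong (⟦ X a ⟧ *_) (*-identityʳ ⟦ Y c ⟧) ⟩
      ⟦ X a ⟧ * ⟦ Y c ⟧                            ∎
    cover : ∀ k → ⟦ sumset X Y τ k ⟧ ≤ ∑ᶠ m λ a → ∑ᶠ m λ c → ⟦ X a ⟧ * (⟦ Y c ⟧ * δ a c k)
    cover k with sum? X Y τ k
    ... | no  _ = z≤n
    ... | yes (a , c , Xa , Yc , eq) = begin
      1                                                     ≡⟨ one ⟨
      ⟦ X a ⟧ * (⟦ Y c ⟧ * δ a c k)                         ≤⟨ ∑-∈ _ (∈-allFin c) ⟩
      ∑ᶠ m (λ c → ⟦ X a ⟧ * (⟦ Y c ⟧ * δ a c k))            ≤⟨ ∑-∈ (λ a → ∑ᶠ m λ c → ⟦ X a ⟧ * (⟦ Y c ⟧ * δ a c k)) (∈-allFin a) ⟩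
      ∑ᶠ m (λ a → ∑ᶠ m λ c → ⟦ X a ⟧ * (⟦ Y c ⟧ * δ a c k)) ∎
      where
      one : ⟦ X a ⟧ * (⟦ Y c ⟧ * δ a c k) ≡ 1
      one rewrite Xa | Yc | does-true (a ⊕ act τ c ≟ᶠ k) eq = refl

  -- A value `k` is left out only if `τ` maps `Y` off the x solutions b of a ⊕ b = k, which by
  -- Bernoulli has probability at most m/(m + x y). Summed over `k`, the expected size of the sumset
  -- is at least m x y/(m + x y).
  ∑-count-sumset : ∀ X Y → m * (m ! * (count X * count Y)) ≤
                   ∑ (perms m) (λ τ → count (sumset X Y τ)) * (m + count X * count Y)
  ∑-count-sumset X Y = begin
    m * (m ! * (x * y))                                           ≡⟨ ∑ᶠ-const m _ ⟨
    ∑ᶠ m (λ k → m ! * (x * y))                                    ≤⟨ ∑-mono (allFin m) covered ⟩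
    ∑ᶠ m (λ k → ∑ (perms m) (λ τ → ⟦ sumset X Y τ k ⟧) * (m + x * y))   ≡⟨ ∑-*ʳ (allFin m) _ (m + x * y) ⟩
    ∑ᶠ m (λ k → ∑ (perms m) (λ τ → ⟦ sumset X Y τ k ⟧)) * (m + x * y)   ≡⟨ cong (_* (m + x * y)) (∑-comm (allFin m) (perms m) _) ⟩
    ∑ (perms m) (λ τ → count (sumset X Y τ)) * (m + x * y)        ∎
    where
    open ≤-Reasoning
    x y : ℕ
    x = count X
    y = count Y
    uncovered : ∀ k → ∑ (perms m) (λ τ → ⟦ not (sumset X Y τ k) ⟧) * (m + x * y) ≤ m * m !
    uncovered k = begin
      ∑ (perms m) (λ τ → ⟦ not (sumset X Y τ k) ⟧) * (m + x * y)
        ≤⟨ *-monoˡ-≤ (m + x * y) (∑-mono (perms m) λ τ → ⟦not⟧≤mapsInto (sum? X Y τ k) Y W τ λ c Yc Wc →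
             let a , Xa , eq = true-does (image? (⊕-solve k) X (act τ c)) (not≢true Wc) in
             a , c , Xa , Yc , trans (cong (a ⊕_) (sym eq)) (⊕-solves k a)) ⟩
      ∑ (perms m) (mapsInto Y W) * (m + x * y)
        ≡⟨ cong (λ a → ∑ (perms m) (mapsInto Y W) * (m + a)) (*-comm x y) ⟩
      ∑ (perms m) (mapsInto Y W) * (m + y * x)
        ≤⟨ mapsInto-bernoulli Y W y (count (not ∘ X)) x ≤-refl (count-not-≤ X _ (count-image (⊕-solve-inj k) X))
             (trans (+-comm (count (not ∘ X)) x) (count-not X)) ⟩
      m * m ! ∎
      where
      W : Fin m → Bool
      W = not ∘ image (⊕-solve k) X
    split : ∀ k → ∑ (perms m) (λ τ → ⟦ sumset X Y τ k ⟧) + ∑ (perms m) (λ τ → ⟦ not (sumset X Y τ k) ⟧) ≡ m !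
    split k = trans (sym (∑-+ (perms m) _ _)) (trans (∑-cong (perms m) λ τ → b+¬b (sumset X Y τ k))
      (trans (∑-const (perms m) 1) (trans (*-identityʳ _) (length-perms m))))
      where
      b+¬b : ∀ b → ⟦ b ⟧ + ⟦ not b ⟧ ≡ 1
      b+¬b true  = refl
      b+¬b false = refl
    covered : ∀ k → m ! * (x * y) ≤ ∑ (perms m) (λ τ → ⟦ sumset X Y τ k ⟧) * (m + x * y)
    covered k = +-cancelˡ-≤ (m * m !) _ _ (begin
      m * m ! + m ! * (x * y)                    ≡⟨ trans (cong (_+ m ! * (x * y)) (*-comm m (m !))) (sym (*-distribˡ-+ (m !) m (x * y))) ⟩
      m ! * (m + x * y)                          ≡⟨ cong (_* (m + x * y)) (split k) ⟨
      (In + Out) * (m + x * y)                   ≡⟨ *-distribʳ-+ (m + x * y) In Out ⟩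
      In * (m + x * y) + Out * (m + x * y)       ≤⟨ +-monoʳ-≤ (In * (m + x * y)) (uncovered k) ⟩
      In * (m + x * y) + m * m !                 ≡⟨ +-comm (In * (m + x * y)) (m * m !) ⟩
      m * m ! + In * (m + x * y)                 ∎)
      where
      In Out : ℕ
      In  = ∑ (perms m) (λ τ → ⟦ sumset X Y τ k ⟧)
      Out = ∑ (perms m) (λ τ → ⟦ not (sumset X Y τ k) ⟧)

  misses≤ : ∀ X Y Z → misses X Y Z ≤ m ! * m !
  misses≤ X Y Z = begin
    misses X Y Z          ≤⟨ ∑-mono Ωs (λ ω → ⟦⟧≤1 _) ⟩
    ∑ Ωs (λ _ → 1)        ≡⟨ ∑-product (perms m) (perms m) _ ⟩
    ∑ (perms m) (λ _ → ∑ (perms m) λ _ → 1)   ≡⟨ ∑-const (perms m) _ ⟩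
    length (perms m) * ∑ (perms m) (λ _ → 1)  ≡⟨ cong₂ _*_ (length-perms m) (trans (∑-const (perms m) 1) (trans (*-identityʳ _) (length-perms m))) ⟩
    m ! * m !             ∎
    where open ≤-Reasoning

  -- For a sumset of size s the miss probability is at most m/(m + s z), which is convex in s. The
  -- statement uses the chord over [0, t], namely 1 - s z/(m + t z): being linear in s, it can be
  -- averaged over `τ` knowing only the mean size of the sumset.
  missesτ-bound : ∀ X Y Z τ t → count (sumset X Y τ) ≤ t →
    ∑ (perms m) (λ σ → miss X Y Z (τ , σ)) * (m + t * count Z) + m ! * (count (sumset X Y τ) * count Z) ≤
    m ! * (m + t * count Z)
  missesτ-bound X Y Z τ t s≤t with r , refl ← m≤n⇒∃[o]m+o≡n s≤t = begin
    F * (m + (s + r) * z) + m ! * (s * z)           ≡⟨ l₁ F m s r z (m !) ⟩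
    F * (m + s * z) + F * (r * z) + m ! * (s * z)   ≤⟨ +-monoˡ-≤ (m ! * (s * z)) (+-mono-≤ bern (*-monoˡ-≤ (r * z) F≤)) ⟩
    m * m ! + m ! * (r * z) + m ! * (s * z)         ≡⟨ l₂ m s r z (m !) ⟩
    m ! * (m + (s + r) * z)                         ∎
    where
    open ≤-Reasoning
    F s z : ℕ
    F = ∑ (perms m) (λ σ → miss X Y Z (τ , σ))
    s = count (sumset X Y τ)
    z = count Z
    l₁ : ∀ F m s r z W → F * (m + (s + r) * z) + W * (s * z) ≡ F * (m + s * z) + F * (r * z) + W * (s * z)
    l₁ = solve-∀
    l₂ : ∀ m s r z W → m * W + W * (r * z) + W * (s * z) ≡ W * (m + (s + r) * z)
    l₂ = solve-∀
    F≤ : F ≤ m !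
    F≤ = ≤-trans (∑-mono (perms m) λ σ → ⟦⟧≤1 _) (≤-reflexive (trans (∑-const (perms m) 1) (trans (*-identityʳ _) (length-perms m))))
    bern : F * (m + s * z) ≤ m * m !
    bern = ≤-trans (*-monoˡ-≤ (m + s * z) (∑-mono (perms m) λ σ →
        miss-σ X Y Z τ σ (sumset X Y τ) λ k Sk → true-does (sum? X Y τ k) Sk))
      (mapsInto-bernoulli (sumset X Y τ) (not ∘ Z) s (count (not ∘ Z)) z ≤-refl ≤-refl
        (trans (+-comm (count (not ∘ Z)) z) (count-not Z)))

  -- Averaging the chord bound and inserting the mean size of the sumset gives miss probability at
  -- most 1 - m x y z/((m + t z)(m + x y)). The hypothesis makes the subtracted fraction at least
  -- 1/4.
  misses-from-sumset : ∀ X Y Z t → (∀ τ → count (sumset X Y τ) ≤ t) →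
    (m + t * count Z) * (m + count X * count Y) ≤ 4 * (m * (count X * count Y * count Z)) →
    4 * misses X Y Z ≤ 3 * (m ! * m !)
  misses-from-sumset X Y Z t s≤t DE≤ = *-cancelʳ-≤ _ _ (D * E) {{DE≢0}} (+-cancelʳ-≤ (V * (D * E)) _ _ (begin
    4 * F * (D * E) + V * (D * E)                         ≤⟨ +-monoʳ-≤ (4 * F * (D * E)) (*-monoʳ-≤ V DE≤) ⟩
    4 * F * (D * E) + V * (4 * (m * (x * y * z)))         ≡⟨ l₁ F D E (m !) m (x * y) z ⟩
    4 * (F * D * E + m ! * z * (m * (m ! * (x * y))))     ≤⟨ *-monoʳ-≤ 4 (+-monoʳ-≤ (F * D * E) (*-monoʳ-≤ (m ! * z) (∑-count-sumset X Y))) ⟩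
    4 * (F * D * E + m ! * z * (S * E))                   ≡⟨ l₂ F D E (m !) z S ⟩
    4 * ((F * D + m ! * (S * z)) * E)                     ≤⟨ *-monoʳ-≤ 4 (*-monoˡ-≤ E summed) ⟩
    4 * (m ! * (m ! * D) * E)                             ≡⟨ l₃ D E (m !) ⟩
    3 * V * (D * E) + V * (D * E)                         ∎))
    where
    open ≤-Reasoning
    x y z F S D E V : ℕ
    x = count X
    y = count Y
    z = count Z
    F = misses X Y Z
    S = ∑ (perms m) λ τ → count (sumset X Y τ)
    D = m + t * z
    E = m + x * y
    V = m ! * m !
    instance
      DE≢0 : NonZero (D * E)
      DE≢0 = m*n≢0 D E {{≢-nonZero (m+n≢0 (t * z))}} {{≢-nonZero (m+n≢0 (x * y))}}
        where
        m+n≢0 : ∀ k → m + k ≢ 0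
        m+n≢0 k eq = ≢-nonZero⁻¹ m (m+n≡0⇒m≡0 m eq)
    l₁ : ∀ F D E W m p z → 4 * F * (D * E) + W * W * (4 * (m * (p * z))) ≡ 4 * (F * D * E + W * z * (m * (W * p)))
    l₁ = solve-∀
    l₂ : ∀ F D E W z S → 4 * (F * D * E + W * z * (S * E)) ≡ 4 * ((F * D + W * (S * z)) * E)
    l₂ = solve-∀
    l₃ : ∀ D E W → 4 * (W * (W * D) * E) ≡ 3 * (W * W) * (D * E) + W * W * (D * E)
    l₃ = solve-∀
    summed : F * D + m ! * (S * z) ≤ m ! * (m ! * D)
    summed = begin
      F * D + m ! * (S * z)
        ≡⟨ cong₂ _+_ (trans (cong (_* D) (misses-στ X Y Z)) (sym (∑-*ʳ (perms m) _ D)))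
                     (trans (cong (m ! *_) (sym (∑-*ʳ (perms m) _ z))) (sym (∑-*ˡ (perms m) (m !) _))) ⟩
      ∑ (perms m) (λ τ → ∑ (perms m) (λ σ → miss X Y Z (τ , σ)) * D) +
      ∑ (perms m) (λ τ → m ! * (count (sumset X Y τ) * z))
        ≡⟨ ∑-+ (perms m) _ _ ⟨
      ∑ (perms m) (λ τ → ∑ (perms m) (λ σ → miss X Y Z (τ , σ)) * D + m ! * (count (sumset X Y τ) * z))
        ≤⟨ ∑-mono (perms m) (λ τ → missesτ-bound X Y Z τ t (s≤t τ)) ⟩
      ∑ (perms m) (λ _ → m ! * D)
        ≡⟨ trans (∑-const (perms m) _) (cong (_* (m ! * D)) (length-perms m)) ⟩
      m ! * (m ! * D) ∎

  -- The cap `t` is the smaller of x y and m, both of which bound the sumset. In either case m + t z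
  -- and m + x y are each at most twice one of their own terms, and the product of these two terms
  -- is m x y z.
  misses-XYZ : ∀ X Y Z → m ≤ count X * count Y * count Z → 4 * misses X Y Z ≤ 3 * (m ! * m !)
  misses-XYZ X Y Z m≤xyz with ≤-total (count X * count Y) m
  ... | inj₁ xy≤m = misses-from-sumset X Y Z (x * y) (count-sumset X Y) (begin
    (m + x * y * z) * (m + x * y)                   ≤⟨ *-mono-≤ (+-monoˡ-≤ (x * y * z) m≤xyz) (+-monoʳ-≤ m xy≤m) ⟩
    (x * y * z + x * y * z) * (m + m)               ≡⟨ lem (x * y) z m ⟩
    4 * (m * (x * y * z))                           ∎)
    where
    open ≤-Reasoning
    x y z : ℕ
    x = count X
    y = count Y
    z = count Z
    lem : ∀ p z m → (p * z + p * z) * (m + m) ≡ 4 * (m * (p * z))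
    lem = solve-∀
  ... | inj₂ m≤xy = misses-from-sumset X Y Z m (λ τ → count≤n (sumset X Y τ)) (begin
    (m + m * z) * (m + x * y)                       ≤⟨ *-mono-≤ (+-monoˡ-≤ (m * z) (m≤m*n m z {{z≢0}})) (+-monoˡ-≤ (x * y) m≤xy) ⟩
    (m * z + m * z) * (x * y + x * y)               ≡⟨ lem (x * y) z m ⟩
    4 * (m * (x * y * z))                           ∎)
    where
    open ≤-Reasoning
    x y z : ℕ
    x = count X
    y = count Y
    z = count Z
    lem : ∀ p z m → (m * z + m * z) * (p + p) ≡ 4 * (m * (p * z))
    lem = solve-∀
    z≢0 : NonZero z
    z≢0 = ≢-nonZero λ z≡0 → ≢-nonZero⁻¹ m (n≤0⇒n≡0 (≤-trans m≤xyz
      (≤-reflexive (trans (cong (x * y *_) z≡0) (*-zeroʳ (x * y))))))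

-- Latin squares assembled from a net

∑ᶠ-+ : ∀ m n (f : Fin (m + n) → ℕ) → ∑ᶠ (m + n) f ≡ ∑ᶠ m (f ∘ (_↑ˡ n)) + ∑ᶠ n (f ∘ (m ↑ʳ_))
∑ᶠ-+ zero    n f = refl
∑ᶠ-+ (suc m) n f = begin
  ∑ᶠ (suc m + n) f                                                            ≡⟨ ∑ᶠ-suc f ⟩
  f zero + ∑ᶠ (m + n) (f ∘ suc)                                               ≡⟨ cong (f zero +_) (∑ᶠ-+ m n (f ∘ suc)) ⟩
  f zero + (∑ᶠ m (f ∘ suc ∘ (_↑ˡ n)) + ∑ᶠ n (f ∘ (suc m ↑ʳ_)))                ≡⟨ +-assoc (f zero) _ _ ⟨
  f zero + ∑ᶠ m (f ∘ suc ∘ (_↑ˡ n)) + ∑ᶠ n (f ∘ (suc m ↑ʳ_))                  ≡⟨ cong (_+ ∑ᶠ n (f ∘ (suc m ↑ʳ_))) (∑ᶠ-suc (f ∘ (_↑ˡ n))) ⟨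
  ∑ᶠ (suc m) (f ∘ (_↑ˡ n)) + ∑ᶠ n (f ∘ (suc m ↑ʳ_))                           ∎
  where open ≡-Reasoning

∑ᶠ-combine : ∀ m n (f : Fin (m * n) → ℕ) → ∑ᶠ (m * n) f ≡ ∑ᶠ m (λ i → ∑ᶠ n λ j → f (combine i j))
∑ᶠ-combine zero    n f = refl
∑ᶠ-combine (suc m) n f = begin
  ∑ᶠ (n + m * n) f                                                                   ≡⟨ ∑ᶠ-+ n (m * n) f ⟩
  ∑ᶠ n (f ∘ (_↑ˡ (m * n))) + ∑ᶠ (m * n) (f ∘ (n ↑ʳ_))                                ≡⟨ cong (∑ᶠ n (f ∘ (_↑ˡ (m * n))) +_) (∑ᶠ-combine m n (f ∘ (n ↑ʳ_))) ⟩
  ∑ᶠ n (f ∘ (_↑ˡ (m * n))) + ∑ᶠ m (λ i → ∑ᶠ n λ j → f (combine (suc i) j))           ≡⟨ ∑ᶠ-suc {m} (λ i → ∑ᶠ n λ j → f (combine i j)) ⟨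
  ∑ᶠ (suc m) (λ i → ∑ᶠ n λ j → f (combine i j))                                      ∎
  where open ≡-Reasoning

∣∣≡∑ : ∀ {n} (X : Subset n) → ∣ X ∣ ≡ ∑ᶠ n (λ i → ⟦ lookup X i ⟧)
∣∣≡∑ []          = refl
∣∣≡∑ (true ∷ X)  = trans (cong suc (∣∣≡∑ X)) (sym (∑ᶠ-suc (⟦_⟧ ∘ lookup (true ∷ X))))
∣∣≡∑ (false ∷ X) = trans (∣∣≡∑ X) (sym (∑ᶠ-suc (⟦_⟧ ∘ lookup (false ∷ X))))

-- Lines of different slopes share at most one point. As there are p² points and p² pairs of
-- intercepts, they then share exactly one.
Orthogonal : ∀ {p} → (Fin p → Fin (p * p) → Fin p) → Set
Orthogonal pt = ∀ {k k′} → k ≢ k′ → ∀ {β β′} → pt k β ≡ pt k β′ → pt k′ β ≡ pt k′ β′ → β ≡ β′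

-- The points of the net are the blocks of the Latin square.  The row (a , b),
-- encoded as combine a b, is the line of slope s a and intercept b, and pt k β
-- is the intercept of the line of slope k through β.
module Net {p : ℕ} (1<p : 1 < p) (pt : Fin p → Fin (p * p) → Fin p) (orth : Orthogonal pt) where

  crossing : Fin p → Fin p → Fin (p * p) → Fin (p * p)
  crossing k k′ β = combine (pt k β) (pt k′ β)

  crossing-injective : ∀ {k k′} → k ≢ k′ → Injective _≡_ _≡_ (crossing k k′)
  crossing-injective {k} {k′} k≢k′ eq =
    let eq₁ , eq₂ = combine-injective (pt k _) (pt k′ _) (pt k _) (pt k′ _) eq in orth k≢k′ eq₁ eq₂

  -- The intercepts for two different slopes are coordinates on the set of points.
  ∑-crossing : ∀ {k k′} → k ≢ k′ → ∀ (f : Fin p → Fin p → ℕ) →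
               ∑ᶠ (p * p) (λ β → f (pt k β) (pt k′ β)) ≡ ∑ᶠ p (λ b → ∑ᶠ p (f b))
  ∑-crossing {k} {k′} k≢k′ f = begin
    ∑ᶠ (p * p) (λ β → f (pt k β) (pt k′ β))                   ≡⟨ ∑-cong (allFin (p * p)) (λ β → sym (g-combine (pt k β) (pt k′ β))) ⟩
    ∑ᶠ (p * p) (g ∘ crossing k k′)                            ≡⟨ ∑ᶠ-injective-≡ (crossing k k′) (crossing-injective k≢k′) g ⟩
    ∑ᶠ (p * p) g                                              ≡⟨ ∑ᶠ-combine p p g ⟩
    ∑ᶠ p (λ b → ∑ᶠ p λ b′ → g (combine b b′))                 ≡⟨ ∑-cong (allFin p) (λ b → ∑-cong (allFin p) (g-combine b)) ⟩
    ∑ᶠ p (λ b → ∑ᶠ p (f b))                                   ∎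
    where
    open ≡-Reasoning
    g : Fin (p * p) → ℕ
    g i = f (proj₁ (remQuot {p} p i)) (proj₂ (remQuot {p} p i))
    g-combine : ∀ b b′ → g (combine b b′) ≡ f b b′
    g-combine b b′ = cong (λ q → f (proj₁ q) (proj₂ q)) (remQuot-combine b b′)

  another : ∀ (k : Fin p) → ∃ λ k′ → k ≢ k′
  another = go 1<p
    where
    go : ∀ {p} → 1 < p → ∀ (k : Fin p) → ∃ λ k′ → k ≢ k′
    go (s≤s (s≤s _)) zero    = suc zero , λ ()
    go (s≤s (s≤s _)) (suc k) = zero , λ ()

  -- Every line has p points; the second slope `k′` serves as a coordinate along it.
  ∑-pt : ∀ k (f : Fin p → ℕ) → ∑ᶠ (p * p) (f ∘ pt k) ≡ p * ∑ᶠ p f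
  ∑-pt k f = let k′ , k≢k′ = another k in begin
    ∑ᶠ (p * p) (f ∘ pt k)             ≡⟨ ∑-crossing k≢k′ (λ b _ → f b) ⟩
    ∑ᶠ p (λ b → ∑ᶠ p λ _ → f b)       ≡⟨ ∑-cong (allFin p) (λ b → ∑ᶠ-const p (f b)) ⟩
    ∑ᶠ p (λ b → p * f b)              ≡⟨ ∑-*ˡ (allFin p) p f ⟩
    p * ∑ᶠ p f                        ∎
    where open ≡-Reasoning

  module _ {m : ℕ} (s : Fin m → Fin p) where

    line : Fin m → Fin (p * p) → Fin (m * p)
    line a β = combine a (pt (s a) β)

    trace : Subset (m * p) → Fin (p * p) → Fin m → Bool
    trace X β a = lookup X (line a β)

    private
      fibre : Subset (m * p) → Fin m → ℕ
      fibre X a = ∑ᶠ p λ b → ⟦ lookup X (combine a b) ⟧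

      ∑-fibre : ∀ X → ∑ᶠ m (fibre X) ≡ ∣ X ∣
      ∑-fibre X = sym (trans (∣∣≡∑ X) (∑ᶠ-combine m p (⟦_⟧ ∘ lookup X)))

      ∑-trace : ∀ X a → ∑ᶠ (p * p) (λ β → ⟦ trace X β a ⟧) ≡ p * fibre X a
      ∑-trace X a = ∑-pt (s a) (λ b → ⟦ lookup X (combine a b) ⟧)

    ∑-count-trace : ∀ X → ∑ᶠ (p * p) (λ β → count (trace X β)) ≡ p * ∣ X ∣
    ∑-count-trace X = begin
      ∑ᶠ (p * p) (λ β → ∑ᶠ m λ a → ⟦ trace X β a ⟧)    ≡⟨ ∑-comm (allFin (p * p)) (allFin m) _ ⟩
      ∑ᶠ m (λ a → ∑ᶠ (p * p) λ β → ⟦ trace X β a ⟧)    ≡⟨ ∑-cong (allFin m) (∑-trace X) ⟩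
      ∑ᶠ m (λ a → p * fibre X a)                       ≡⟨ ∑-*ˡ (allFin m) p (fibre X) ⟩
      p * ∑ᶠ m (fibre X)                               ≡⟨ cong (p *_) (∑-fibre X) ⟩
      p * ∣ X ∣                                        ∎
      where open ≡-Reasoning

    ∑-count-trace² : Injective _≡_ _≡_ s → ∀ X →
      ∑ᶠ (p * p) (λ β → count (trace X β) * count (trace X β)) ≤ p * ∣ X ∣ + ∣ X ∣ * ∣ X ∣
    ∑-count-trace² s-inj X = begin
      ∑ᶠ (p * p) (λ β → count (trace X β) * count (trace X β))
        ≡⟨ ∑-cong (allFin (p * p)) square ⟩
      ∑ᶠ (p * p) (λ β → ∑ᶠ m λ a → ∑ᶠ m λ a′ → u a β * u a′ β)
        ≡⟨ ∑-comm (allFin (p * p)) (allFin m) _ ⟩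
      ∑ᶠ m (λ a → ∑ᶠ (p * p) λ β → ∑ᶠ m λ a′ → u a β * u a′ β)
        ≡⟨ ∑-cong (allFin m) (λ a → ∑-comm (allFin (p * p)) (allFin m) _) ⟩
      ∑ᶠ m (λ a → ∑ᶠ m λ a′ → ∑ᶠ (p * p) λ β → u a β * u a′ β)
        ≤⟨ ∑-mono (allFin m) (λ a → ∑-mono (allFin m) (pair a)) ⟩
      ∑ᶠ m (λ a → ∑ᶠ m λ a′ → p * fibre X a * ⟦ does (a ≟ᶠ a′) ⟧ + fibre X a * fibre X a′)
        ≤⟨ ∑-mono (allFin m) row ⟩
      ∑ᶠ m (λ a → p * fibre X a + fibre X a * ∣ X ∣)
        ≡⟨ trans (∑-+ (allFin m) _ _) (cong₂ _+_ (∑-*ˡ (allFin m) p (fibre X)) (∑-*ʳ (allFin m) (fibre X) ∣ X ∣)) ⟩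
      p * ∑ᶠ m (fibre X) + ∑ᶠ m (fibre X) * ∣ X ∣
        ≡⟨ cong (λ f → p * f + f * ∣ X ∣) (∑-fibre X) ⟩
      p * ∣ X ∣ + ∣ X ∣ * ∣ X ∣ ∎
      where
      open ≤-Reasoning
      u : Fin m → Fin (p * p) → ℕ
      u a β = ⟦ trace X β a ⟧
      square : ∀ β → count (trace X β) * count (trace X β) ≡ ∑ᶠ m λ a → ∑ᶠ m λ a′ → u a β * u a′ β
      square β = sym (trans (∑-cong (allFin m) λ a → ∑-*ˡ (allFin m) (u a β) _) (∑-*ʳ (allFin m) _ _))
      idem : ∀ b → ⟦ b ⟧ * ⟦ b ⟧ ≡ ⟦ b ⟧
      idem true  = refl
      idem false = refl
      -- For one slope, a point lies on a single line of it, so the product of indicators is the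
      -- indicator itself. For two slopes, each pair of lines meets in exactly one point.
      pair : ∀ a a′ → ∑ᶠ (p * p) (λ β → u a β * u a′ β) ≤ p * fibre X a * ⟦ does (a ≟ᶠ a′) ⟧ + fibre X a * fibre X a′
      pair a a′ with a ≟ᶠ a′
      ... | yes refl = ≤-trans
        (≤-reflexive (trans (∑-cong (allFin (p * p)) λ β → idem (trace X β a)) (trans (∑-trace X a) (sym (*-identityʳ _)))))
        (m≤m+n (p * fibre X a * 1) _)
      ... | no a≢a′ = ≤-trans (≤-reflexive (trans
        (∑-crossing {s a} {s a′} (a≢a′ ∘ s-inj) λ b b′ → ⟦ lookup X (combine a b) ⟧ * ⟦ lookup X (combine a′ b′) ⟧)
        (trans (∑-cong (allFin p) λ b → ∑-*ˡ (allFin p) ⟦ lookup X (combine a b) ⟧ _) (∑-*ʳ (allFin p) _ (fibre X a′)))))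
        (m≤n+m (fibre X a * fibre X a′) _)
      row : ∀ a → ∑ᶠ m (λ a′ → p * fibre X a * ⟦ does (a ≟ᶠ a′) ⟧ + fibre X a * fibre X a′) ≤ p * fibre X a + fibre X a * ∣ X ∣
      row a = begin
        ∑ᶠ m (λ a′ → p * fibre X a * ⟦ does (a ≟ᶠ a′) ⟧ + fibre X a * fibre X a′)
          ≡⟨ trans (∑-+ (allFin m) _ _) (cong₂ _+_ (∑-*ˡ (allFin m) (p * fibre X a) _) (∑-*ˡ (allFin m) (fibre X a) (fibre X))) ⟩
        p * fibre X a * ∑ᶠ m (λ a′ → ⟦ does (a ≟ᶠ a′) ⟧) + fibre X a * ∑ᶠ m (fibre X)
          ≤⟨ +-mono-≤ (*-monoʳ-≤ (p * fibre X a) (∑-indicator a)) (≤-reflexive (cong (fibre X a *_) (∑-fibre X))) ⟩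
        p * fibre X a * 1 + fibre X a * ∣ X ∣
          ≡⟨ cong (_+ fibre X a * ∣ X ∣) (*-identityʳ (p * fibre X a)) ⟩
        p * fibre X a + fibre X a * ∣ X ∣ ∎

  module Assembled {m : ℕ} (r c s : Fin m → Fin p)
    (r≢c : ∀ a b → r a ≢ c b) (r≢s : ∀ a b → r a ≢ s b) (c≢s : ∀ a b → c a ≢ s b)
    (M : Fin (p * p) → Fin m → Fin m → Fin m)
    (M-injˡ : ∀ β b → Injective _≡_ _≡_ (λ a → M β a b))
    (M-injʳ : ∀ β a → Injective _≡_ _≡_ (M β a)) where

    private
      meet : ∀ a b (i j : Fin p) → ∃ λ β → pt (r a) β ≡ i × pt (c b) β ≡ j
      meet a b i j with β , eq ← injective⇒surjective (crossing (r a) (c b)) (crossing-injective (r≢c a b)) (combine i j) =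
        β , combine-injective (pt (r a) β) (pt (c b) β) i j eq

      cell : Fin m × Fin p → Fin m × Fin p → Fin (m * p)
      cell (a , i) (b , j) = let β , _ = meet a b i j in line s (M β a b) β

    product : Fin (m * p) → Fin (m * p) → Fin (m * p)
    product x y = cell (remQuot p x) (remQuot p y)

    product-line : ∀ β a b → product (line r a β) (line c b β) ≡ line s (M β a b) β
    product-line β a b = trans
      (cong₂ cell (remQuot-combine a (pt (r a) β)) (remQuot-combine b (pt (c b) β)))
      (let γ , eq₁ , eq₂ = meet a b (pt (r a) β) (pt (c b) β) in
       cong (λ β → line s (M β a b) β) (orth (r≢c a b) {γ} {β} eq₁ eq₂))

    private
      -- A view of a row and a column through their common point, so that the injectivity proofs
      -- compare points and local indices directly.
      data Meet : Fin (m * p) → Fin (m * p) → Set where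
        at : ∀ β a b → Meet (line r a β) (line c b β)

      view : ∀ x y → Meet x y
      view x y with combine-surjective {m} {p} x | combine-surjective {m} {p} y
      ... | a , i , refl | b , j , refl with β , refl , refl ← meet a b i j = at β a b

      line-injective : ∀ (s : Fin m → Fin p) {a a′ β β′} → line s a β ≡ line s a′ β′ → a ≡ a′ × pt (s a) β ≡ pt (s a) β′
      line-injective s {a} {a′} {β} {β′} eq with combine-injective a (pt (s a) β) a′ (pt (s a′) β′) eq
      ... | refl , eq′ = refl , eq′

      -- With equal rows and equal symbols, `β` and `β′` share a row line and a symbol line. These
      -- have different slopes, so the points coincide and the local square at that point decides.
      row-inj : ∀ {x x′ y y′} → Meet x y → Meet x′ y′ → x ≡ x′ → product x y ≡ product x′ y′ → y ≡ y′
      row-inj (at β a b) (at β′ a′ b′) x≡x′ eq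
        with refl , eqʳ ← line-injective r {a} {a′} {β} {β′} x≡x′
        with e≡ , eqˢ ← line-injective s {M β a b} {M β′ a b′} {β} {β′} (trans (sym (product-line β a b)) (trans eq (product-line β′ a b′)))
        with refl ← orth (r≢s a (M β a b)) {β} {β′} eqʳ eqˢ
        = cong (λ b → line c b β) (M-injʳ β a e≡)

      col-inj : ∀ {x x′ y y′} → Meet x y → Meet x′ y′ → y ≡ y′ → product x y ≡ product x′ y′ → x ≡ x′
      col-inj (at β a b) (at β′ a′ b′) y≡y′ eq
        with refl , eqᶜ ← line-injective c {b} {b′} {β} {β′} y≡y′
        with e≡ , eqˢ ← line-injective s {M β a b} {M β′ a′ b} {β} {β′} (trans (sym (product-line β a b)) (trans eq (product-line β′ a′ b)))
        with refl ← orth (c≢s b (M β a b)) {β} {β′} eqᶜ eqˢ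
        = cong (λ a → line r a β) (M-injˡ β b e≡)

    latinSquare : LatinSquare (m * p)
    latinSquare = record
      { L      = product
      ; rowBij = λ x → injective⇒bijective (product x) (λ {y} {y′} → row-inj (view x y) (view x y′) refl)
      ; colBij = λ y → injective⇒bijective (λ x → product x y) (λ {x} {x′} → col-inj (view x y) (view x′ y) refl)
      }

    empty⇒no-hit : ∀ {X Y Z} → IsEmptyBox latinSquare X Y Z → ∀ β a b →
      trace r X β a ≡ true → trace c Y β b ≡ true → ¬ trace s Z β (M β a b) ≡ true
    empty⇒no-hit {X} {Y} {Z} empty β a b Xa Yb Zab =
      empty (line r a β) (line c b β) (lookup⇒[]= _ X Xa) (lookup⇒[]= _ Y Yb)
        (subst (_∈ₛ Z) (sym (product-line β a b)) (lookup⇒[]= _ Z Zab))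

-- Products and the choice of local squares

∏ᶠ : ∀ n → (Fin n → ℕ) → ℕ
∏ᶠ zero    f = 1
∏ᶠ (suc n) f = f zero * ∏ᶠ n (f ∘ suc)

∏ᶠ-ones : ∀ {f : Fin n → ℕ} → (∀ i → f i ≡ 1) → ∏ᶠ n f ≡ 1
∏ᶠ-ones {zero}  f≡1 = refl
∏ᶠ-ones {suc n} f≡1 = cong₂ _*_ (f≡1 zero) (∏ᶠ-ones (f≡1 ∘ suc))

∏ᶠ-bound : ∀ (f : Fin n → ℕ) (good : Fin n → Bool) V a b →
           (∀ i → f i ≤ V) → (∀ i → good i ≡ true → f i * b ≤ a * V) →
           ∏ᶠ n f * b ^ count good ≤ a ^ count good * V ^ n
∏ᶠ-bound {zero}  f good V a b f≤ g≤ = ≤-refl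
∏ᶠ-bound {suc n} f good V a b f≤ g≤ rewrite ∑ᶠ-suc (⟦_⟧ ∘ good) = begin
  f zero * P * b ^ (⟦ good zero ⟧ + c)             ≡⟨ cong (f zero * P *_) (^-distribˡ-+-* b ⟦ good zero ⟧ c) ⟩
  f zero * P * (b ^ ⟦ good zero ⟧ * b ^ c)         ≡⟨ interchange (f zero) P (b ^ ⟦ good zero ⟧) (b ^ c) ⟩
  f zero * b ^ ⟦ good zero ⟧ * (P * b ^ c)         ≤⟨ *-mono-≤ head (∏ᶠ-bound (f ∘ suc) (good ∘ suc) V a b (f≤ ∘ suc) (g≤ ∘ suc)) ⟩
  a ^ ⟦ good zero ⟧ * V * (a ^ c * V ^ n)          ≡⟨ interchange (a ^ ⟦ good zero ⟧) V (a ^ c) (V ^ n) ⟩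
  a ^ ⟦ good zero ⟧ * a ^ c * (V * V ^ n)          ≡⟨ cong (_* (V * V ^ n)) (^-distribˡ-+-* a ⟦ good zero ⟧ c) ⟨
  a ^ (⟦ good zero ⟧ + c) * V ^ suc n              ∎
  where
  open ≤-Reasoning
  P c : ℕ
  P = ∏ᶠ n (f ∘ suc)
  c = count (good ∘ suc)
  interchange : ∀ a b c d → a * b * (c * d) ≡ a * c * (b * d)
  interchange = solve-∀
  head : f zero * b ^ ⟦ good zero ⟧ ≤ a ^ ⟦ good zero ⟧ * V
  head with good zero in eq
  ... | true  = subst₂ (λ s t → f zero * s ≤ t * V) (sym (*-identityʳ b)) (sym (*-identityʳ a)) (g≤ zero eq)
  ... | false = subst₂ _≤_ (sym (*-identityʳ (f zero))) (sym (*-identityˡ V)) (f≤ zero)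

-- The method of conditional expectations, with w b the weight that the choices
-- made so far leave on b.
choose : ∀ n (as : List A) (bs : List B) (w : B → ℕ) (g : Fin n → B → A → ℕ) →
         ∑ bs (λ b → w b * ∏ᶠ n λ i → ∑ as (g i b)) < length as ^ n →
         ∃ λ (f : Fin n → A) → ∑ bs (λ b → w b * ∏ᶠ n λ i → g i b (f i)) < 1
choose zero    as bs w g lt = (λ ()) , lt
choose (suc n) as bs w g lt =
  let a , lt₁ = ∑-pigeonhole as (λ a → ∑ bs λ b → w b * g zero b a * R b) _ (subst (_< length as ^ suc n) expand lt)
      f , lt₂ = choose n as bs (λ b → w b * g zero b a) (g ∘ suc) lt₁
  in  (λ { zero → a ; (suc i) → f i }) , subst (_< 1) (∑-cong bs λ b → *-assoc (w b) _ _) lt₂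
  where
  open ≡-Reasoning
  R : _ → ℕ
  R b = ∏ᶠ n λ i → ∑ as (g (suc i) b)
  expand : ∑ bs (λ b → w b * (∑ as (g zero b) * R b)) ≡ ∑ as (λ a → ∑ bs λ b → w b * g zero b a * R b)
  expand = begin
    ∑ bs (λ b → w b * (∑ as (g zero b) * R b))        ≡⟨ ∑-cong bs (λ b → trans (sym (*-assoc (w b) _ _)) (trans (cong (_* R b) (sym (∑-*ˡ as (w b) _))) (sym (∑-*ʳ as _ (R b))))) ⟩
    ∑ bs (λ b → ∑ as λ a → w b * g zero b a * R b)    ≡⟨ ∑-comm bs as _ ⟩
    ∑ as (λ a → ∑ bs λ b → w b * g zero b a * R b)    ∎

-- Second moments over the points of the net

-- `X` lines, `x β` of them through `β`, with mean X/p. These two moments are all that the estimates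
-- below take from the geometry.
record Spread (p X : ℕ) (x : Fin (p * p) → ℕ) : Set where
  field
    total  : ∑ᶠ (p * p) x ≡ p * X
    energy : ∑ᶠ (p * p) (λ β → x β * x β) ≤ p * X + X * X

2ab≤a²+b² : ∀ a b → 2 * (a * b) ≤ a * a + b * b
2ab≤a²+b² a b with ≤-total a b
... | inj₁ a≤b with d , refl ← m≤n⇒∃[o]m+o≡n a≤b = ≤-trans (m≤m+n _ (d * d)) (≤-reflexive (lem a d))
  where
  lem : ∀ a d → 2 * (a * (a + d)) + d * d ≡ a * a + (a + d) * (a + d)
  lem = solve-∀
2ab≤a²+b² a b | inj₂ b≤a with d , refl ← m≤n⇒∃[o]m+o≡n b≤a = ≤-trans (m≤m+n _ (d * d)) (≤-reflexive (lem b d))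
  where
  lem : ∀ b d → 2 * ((b + d) * b) + d * d ≡ (b + d) * (b + d) + b * b
  lem = solve-∀

-- (2q − 2X)² ≥ X² for 2q ≤ X, expanded so that no subtraction occurs.
8Xq+X²≤4q²+4X² : ∀ q X → 2 * q ≤ X → 8 * (X * q) + X * X ≤ 4 * (q * q) + 4 * (X * X)
8Xq+X²≤4q²+4X² q X 2q≤X with d , refl ← m≤n⇒∃[o]m+o≡n 2q≤X =
  ≤-trans (m≤m+n _ (4 * (q * d) + 3 * (d * d))) (≤-reflexive (lem q d))
  where
  lem : ∀ q d → 8 * ((2 * q + d) * q) + (2 * q + d) * (2 * q + d) + (4 * (q * d) + 3 * (d * d)) ≡ 4 * (q * q) + 4 * ((2 * q + d) * (2 * q + d))
  lem = solve-∀

module _ {p X : ℕ} {x : Fin (p * p) → ℕ} (spread : Spread p X x) where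
  open Spread spread

  -- At most half the mean X/p.
  thin : Fin (p * p) → Bool
  thin β = does (2 * (p * x β) ≤? X)

  touched : Fin (p * p) → Bool
  touched β = does (1 ≤? x β)

  not-thin⇒ : ∀ β → thin β ≡ false → X ≤ 2 * (p * x β)
  not-thin⇒ β eq = <⇒≤ (≰⇒> (false-does (2 * (p * x β) ≤? X) eq))

  private
    N : ℕ
    N = p * p

    ∑-scaled : ∀ c d → ∑ᶠ N (λ β → c * (d * (p * x β))) ≡ c * (d * (p * (p * X)))
    ∑-scaled c d = trans (∑-*ˡ (allFin N) c _) (cong (c *_) (trans (∑-*ˡ (allFin N) d _)
      (cong (d *_) (trans (∑-*ˡ (allFin N) p x) (cong (p *_) total)))))

    ∑-squared : ∑ᶠ N (λ β → (p * x β) * (p * x β)) ≤ p * p * (p * X + X * X)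
    ∑-squared = ≤-trans
      (≤-reflexive (trans (∑-cong (allFin N) λ β → sq p (x β)) (∑-*ˡ (allFin N) (p * p) _)))
      (*-monoʳ-≤ (p * p) energy)
      where
      sq : ∀ p x → (p * x) * (p * x) ≡ p * p * (x * x)
      sq = solve-∀

  -- Chebyshev for q = p x, whose mean is X: the quantity 4(q - X)² is at least X² at thin points
  -- and nonnegative elsewhere, while the sum of (q - X)² is at most p³ X.
  count-thin : count thin * X ≤ 4 * (p * p * p)
  count-thin with X ≟ⁿ 0
  ... | yes refl = ≤-trans (≤-reflexive (*-zeroʳ (count thin))) z≤n
  ... | no  X≢0  = *-cancelʳ-≤ _ _ X {{≢-nonZero X≢0}} (+-cancelˡ-≤ (8 * (X * (p * (p * X)))) _ _ (begin
    8 * (X * (p * (p * X))) + count thin * X * X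
      ≡⟨ cong₂ _+_ (∑-scaled 8 X) (trans (∑-*ʳ (allFin N) _ (X * X)) (sym (*-assoc (count thin) X X))) ⟨
    ∑ᶠ N (λ β → 8 * (X * (p * x β))) + ∑ᶠ N (λ β → ⟦ thin β ⟧ * (X * X))
      ≡⟨ ∑-+ (allFin N) _ _ ⟨
    ∑ᶠ N (λ β → 8 * (X * (p * x β)) + ⟦ thin β ⟧ * (X * X))
      ≤⟨ ∑-mono (allFin N) pointwise ⟩
    ∑ᶠ N (λ β → 4 * ((p * x β) * (p * x β)) + 4 * (X * X))
      ≡⟨ trans (∑-+ (allFin N) _ _) (cong₂ _+_ (∑-*ˡ (allFin N) 4 _) (∑ᶠ-const N _)) ⟩
    4 * ∑ᶠ N (λ β → (p * x β) * (p * x β)) + p * p * (4 * (X * X))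
      ≤⟨ +-monoˡ-≤ _ (*-monoʳ-≤ 4 ∑-squared) ⟩
    4 * (p * p * (p * X + X * X)) + p * p * (4 * (X * X))
      ≡⟨ lem p X ⟩
    8 * (X * (p * (p * X))) + 4 * (p * p * p) * X ∎))
    where
    open ≤-Reasoning
    lem : ∀ p X → 4 * (p * p * (p * X + X * X)) + p * p * (4 * (X * X)) ≡ 8 * (X * (p * (p * X))) + 4 * (p * p * p) * X
    lem = solve-∀
    rearrange : ∀ q X → 4 * (2 * (X * q)) ≡ 8 * (X * q) + 0
    rearrange = solve-∀
    pointwise : ∀ β → 8 * (X * (p * x β)) + ⟦ thin β ⟧ * (X * X) ≤ 4 * ((p * x β) * (p * x β)) + 4 * (X * X)
    pointwise β with thin β in eq
    ... | true  = subst (λ s → 8 * (X * (p * x β)) + s ≤ 4 * ((p * x β) * (p * x β)) + 4 * (X * X)) (sym (*-identityˡ (X * X)))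
      (8Xq+X²≤4q²+4X² (p * x β) X (true-does (2 * (p * x β) ≤? X) eq))
    ... | false = begin
      8 * (X * (p * x β)) + 0                             ≡⟨ rearrange (p * x β) X ⟨
      4 * (2 * (X * (p * x β)))                           ≤⟨ *-monoʳ-≤ 4 (2ab≤a²+b² X (p * x β)) ⟩
      4 * (X * X + (p * x β) * (p * x β))                 ≡⟨ trans (cong (4 *_) (+-comm (X * X) ((p * x β) * (p * x β)))) (*-distribˡ-+ 4 ((p * x β) * (p * x β)) (X * X)) ⟩
      4 * ((p * x β) * (p * x β)) + 4 * (X * X)           ∎

  -- Cauchy-Schwarz in linear form: with q = p x, sum 2(p + X) q ≤ q² + (p + X)² over the touched
  -- points. The multiplier p + X is the ratio of the bound on the sum of q² to the sum of q.
  count-touched : .{{_ : NonZero p}} → p * p * X ≤ (p + X) * count touched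
  count-touched = *-cancelʳ-≤ _ _ (p + X) {{p+X≢0}} (+-cancelˡ-≤ (p * p * (p * X + X * X)) _ _ (begin
    p * p * (p * X + X * X) + p * p * X * (p + X)
      ≡⟨ lem₁ p X ⟩
    2 * ((p + X) * (p * (p * X)))
      ≡⟨ ∑-scaled 2 (p + X) ⟨
    ∑ᶠ N (λ β → 2 * ((p + X) * (p * x β)))
      ≤⟨ ∑-mono (allFin N) pointwise ⟩
    ∑ᶠ N (λ β → (p * x β) * (p * x β) + ⟦ touched β ⟧ * ((p + X) * (p + X)))
      ≡⟨ trans (∑-+ (allFin N) _ _) (cong (∑ᶠ N (λ β → (p * x β) * (p * x β)) +_) (∑-*ʳ (allFin N) _ _)) ⟩
    ∑ᶠ N (λ β → (p * x β) * (p * x β)) + count touched * ((p + X) * (p + X))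
      ≤⟨ +-monoˡ-≤ _ ∑-squared ⟩
    p * p * (p * X + X * X) + count touched * ((p + X) * (p + X))
      ≡⟨ cong (p * p * (p * X + X * X) +_) (lem₂ (count touched) (p + X)) ⟩
    p * p * (p * X + X * X) + (p + X) * count touched * (p + X) ∎))
    where
    open ≤-Reasoning
    p+X≢0 : NonZero (p + X)
    p+X≢0 = ≢-nonZero λ eq → ≢-nonZero⁻¹ p (m+n≡0⇒m≡0 p eq)
    lem₁ : ∀ p X → p * p * (p * X + X * X) + p * p * X * (p + X) ≡ 2 * ((p + X) * (p * (p * X)))
    lem₁ = solve-∀
    lem₂ : ∀ c d → c * (d * d) ≡ d * c * d
    lem₂ = solve-∀
    pointwise : ∀ β → 2 * ((p + X) * (p * x β)) ≤ (p * x β) * (p * x β) + ⟦ touched β ⟧ * ((p + X) * (p + X))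
    pointwise β with x β
    ... | zero  = ≤-trans (≤-reflexive (lem₀ p X)) z≤n
      where
      lem₀ : ∀ p X → 2 * ((p + X) * (p * 0)) ≡ 0
      lem₀ = solve-∀
    ... | suc k = begin
      2 * ((p + X) * (p * suc k))                                      ≤⟨ 2ab≤a²+b² (p + X) (p * suc k) ⟩
      (p + X) * (p + X) + (p * suc k) * (p * suc k)                    ≡⟨ +-comm ((p + X) * (p + X)) _ ⟩
      (p * suc k) * (p * suc k) + (p + X) * (p + X)                    ≡⟨ cong ((p * suc k) * (p * suc k) +_) (*-identityˡ _) ⟨
      (p * suc k) * (p * suc k) + 1 * ((p + X) * (p + X))              ∎

-- Boxes of large volume

count-filter : ∀ (P Q : Fin n → Bool) → count P ≤ count (λ i → P i ∧ not (Q i)) + count Q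
count-filter {n} P Q = ≤-trans (∑-mono (allFin n) λ i → lem (P i) (Q i)) (≤-reflexive (∑-+ (allFin n) _ _))
  where
  lem : ∀ b c → ⟦ b ⟧ ≤ ⟦ b ∧ not c ⟧ + ⟦ c ⟧
  lem true  true  = s≤s z≤n
  lem true  false = s≤s z≤n
  lem false c     = z≤n

∧-true : ∀ b c → b ∧ not c ≡ true → b ≡ true × c ≡ false
∧-true true false _ = refl , refl

count-const-true : ∀ n → count {n} (λ _ → true) ≡ n
count-const-true n = trans (∑ᶠ-const n 1) (*-identityʳ n)

ceil-quotient : ∀ a b .{{_ : NonZero b}} → ∃ λ j → a ≤ j * b × j * b ≤ a + b
ceil-quotient a b = suc (a / b) ,
  (begin
    a                     ≡⟨ m≡m%n+[m/n]*n a b ⟩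
    a % b + a / b * b     ≤⟨ +-monoˡ-≤ (a / b * b) (<⇒≤ (m%n<n a b)) ⟩
    b + a / b * b         ∎) ,
  (begin
    b + a / b * b         ≤⟨ +-monoʳ-≤ b (m/n*n≤m a b) ⟩
    b + a                 ≡⟨ +-comm b a ⟩
    a + b                 ∎)
  where open ≤-Reasoning

floor-quotient : ∀ a b .{{_ : NonZero b}} → ∃ λ g → g * b ≤ a × a < suc g * b
floor-quotient a b = a / b , m/n*n≤m a b , (begin-strict
    a                     ≡⟨ m≡m%n+[m/n]*n a b ⟩
    a % b + a / b * b     <⟨ +-monoˡ-< (a / b * b) (m%n<n a b) ⟩
    b + a / b * b         ∎)
  where open ≤-Reasoning

-- Twelve factors 3/4 pay for one factor 16, since 3^12 · 16 ≤ 4^12.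
3/4-power : ∀ G n → 12 * n ≤ G → 3 ^ G * 16 ^ n ≤ 4 ^ G
3/4-power G n 12n≤G with r , refl ← m≤n⇒∃[o]m+o≡n 12n≤G = begin
  3 ^ (12 * n + r) * 16 ^ n           ≡⟨ cong (_* 16 ^ n) (^-distribˡ-+-* 3 (12 * n) r) ⟩
  3 ^ (12 * n) * 3 ^ r * 16 ^ n       ≡⟨ swap (3 ^ (12 * n)) (3 ^ r) (16 ^ n) ⟩
  3 ^ (12 * n) * 16 ^ n * 3 ^ r       ≤⟨ *-mono-≤ (go n) (^-monoˡ-≤ r (s≤s (s≤s (s≤s z≤n)))) ⟩
  4 ^ (12 * n) * 4 ^ r                ≡⟨ ^-distribˡ-+-* 4 (12 * n) r ⟨
  4 ^ (12 * n + r)                    ∎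
  where
  open ≤-Reasoning
  swap : ∀ a b c → a * b * c ≡ a * c * b
  swap = solve-∀
  interchange : ∀ a b c d → a * b * (c * d) ≡ a * c * (b * d)
  interchange = solve-∀
  power-suc : ∀ a k → a ^ (12 * suc k) ≡ a ^ 12 * a ^ (12 * k)
  power-suc a k = trans (cong (a ^_) (*-suc 12 k)) (^-distribˡ-+-* a 12 (12 * k))
  go : ∀ n → 3 ^ (12 * n) * 16 ^ n ≤ 4 ^ (12 * n)
  go zero    = ≤-refl
  go (suc k) = begin
    3 ^ (12 * suc k) * (16 * 16 ^ k)              ≡⟨ cong (_* (16 * 16 ^ k)) (power-suc 3 k) ⟩
    3 ^ 12 * 3 ^ (12 * k) * (16 * 16 ^ k)         ≡⟨ interchange (3 ^ 12) (3 ^ (12 * k)) 16 (16 ^ k) ⟩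
    3 ^ 12 * 16 * (3 ^ (12 * k) * 16 ^ k)         ≤⟨ *-mono-≤ (≤ᵇ⇒≤ (3 ^ 12 * 16) (4 ^ 12) tt) (go k) ⟩
    4 ^ 12 * 4 ^ (12 * k)                         ≡⟨ power-suc 4 k ⟨
    4 ^ (12 * suc k)                              ∎

module Volume (p m V : ℕ) .{{p≢0 : NonZero p}} .{{m≢0 : NonZero m}}
  (48m≤p : 48 * m ≤ p) (p≤96m : p ≤ 96 * m) (C : ℕ) (C≥ : 272 * 96 ≤ C)
  (f : Fin (p * p) → ℕ) (f≤V : ∀ β → f β ≤ V) where

  -- With `f β` of the `V` local choices at `β` missing the box, this says that the box is missed at
  -- every point with probability at most 16⁻ⁿ.
  Conclusion : Set
  Conclusion = ∏ᶠ (p * p) f * 16 ^ (m * p) ≤ V ^ (p * p)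

  Large : ℕ → ℕ → ℕ → Set
  Large X Y Z = C * (m * p * (m * p)) < X * Y * Z

  module _ {X Y Z : ℕ} {x y z : Fin (p * p) → ℕ}
    (sx : Spread p X x) (sy : Spread p Y y) (sz : Spread p Z z) where

    all-wide : 16 * p ≤ X → 16 * p ≤ Y → 16 * p ≤ Z → Large X Y Z →
               (∀ β → m ≤ x β * y β * z β → 4 * f β ≤ 3 * V) → Conclusion
    all-wide X≥ Y≥ Z≥ large hit = *-cancelʳ-≤ _ _ (4 ^ G) {{m^n≢0 4 G}} (begin
      ∏ᶠ N f * 16 ^ (m * p) * 4 ^ G      ≡⟨ l₁ (∏ᶠ N f) (16 ^ (m * p)) (4 ^ G) ⟩
      ∏ᶠ N f * 4 ^ G * 16 ^ (m * p)      ≤⟨ *-monoˡ-≤ (16 ^ (m * p)) (∏ᶠ-bound f good V 3 4 f≤V λ β gβ → ≤-trans (≤-reflexive (*-comm (f β) 4)) (hit β (good⇒ β gβ))) ⟩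
      3 ^ G * V ^ N * 16 ^ (m * p)       ≡⟨ l₁ (3 ^ G) (V ^ N) (16 ^ (m * p)) ⟩
      3 ^ G * 16 ^ (m * p) * V ^ N       ≤⟨ *-monoˡ-≤ (V ^ N) (3/4-power G (m * p) 12n≤G) ⟩
      4 ^ G * V ^ N                      ≡⟨ *-comm (4 ^ G) (V ^ N) ⟩
      V ^ N * 4 ^ G                      ∎)
      where
      open ≤-Reasoning
      N : ℕ
      N = p * p
      l₁ : ∀ a b c → a * b * c ≡ a * c * b
      l₁ = solve-∀
      good₁ good₂ good : Fin N → Bool
      good₁ β = true ∧ not (thin sx β)
      good₂ β = good₁ β ∧ not (thin sy β)
      good  β = good₂ β ∧ not (thin sz β)
      G : ℕ
      G = count good
      few : ∀ {X x} (s : Spread p X x) → 16 * p ≤ X → 4 * count (thin s) ≤ p * p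
      few {X} s 16p≤X = *-cancelʳ-≤ _ _ (4 * p) {{m*n≢0 4 p}} (begin
        4 * count (thin s) * (4 * p)   ≡⟨ l₂ (count (thin s)) p ⟩
        count (thin s) * (16 * p)      ≤⟨ *-monoʳ-≤ (count (thin s)) 16p≤X ⟩
        count (thin s) * X             ≤⟨ count-thin s ⟩
        4 * (p * p * p)                ≡⟨ l₃ p ⟩
        p * p * (4 * p)                ∎)
        where
        l₂ : ∀ c p → 4 * c * (4 * p) ≡ c * (16 * p)
        l₂ = solve-∀
        l₃ : ∀ p → 4 * (p * p * p) ≡ p * p * (4 * p)
        l₃ = solve-∀
      covered : N ≤ G + count (thin sz) + count (thin sy) + count (thin sx)
      covered = begin
        N                                                             ≡⟨ count-const-true N ⟨
        count {N} (λ _ → true)                                         ≤⟨ count-filter {N} (λ _ → true) (thin sx) ⟩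
        count good₁ + count (thin sx)                                 ≤⟨ +-monoˡ-≤ _ (count-filter good₁ (thin sy)) ⟩
        count good₂ + count (thin sy) + count (thin sx)               ≤⟨ +-monoˡ-≤ _ (+-monoˡ-≤ _ (count-filter good₂ (thin sz))) ⟩
        G + count (thin sz) + count (thin sy) + count (thin sx)       ∎
      N≤4G : N ≤ 4 * G
      N≤4G = +-cancelʳ-≤ (N + N + N) _ _ (begin
        N + (N + N + N)                                                         ≡⟨ l₄ N ⟩
        4 * N                                                                   ≤⟨ *-monoʳ-≤ 4 covered ⟩
        4 * (G + count (thin sz) + count (thin sy) + count (thin sx))           ≡⟨ l₅ G (count (thin sz)) (count (thin sy)) (count (thin sx)) ⟩
        4 * G + (4 * count (thin sz) + 4 * count (thin sy) + 4 * count (thin sx)) ≤⟨ +-monoʳ-≤ (4 * G) (+-mono-≤ (+-mono-≤ (few sz Z≥) (few sy Y≥)) (few sx X≥)) ⟩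
        4 * G + (N + N + N)                                                     ∎)
        where
        l₄ : ∀ N → N + (N + N + N) ≡ 4 * N
        l₄ = solve-∀
        l₅ : ∀ G a b c → 4 * (G + a + b + c) ≡ 4 * G + (4 * a + 4 * b + 4 * c)
        l₅ = solve-∀
      -- Here 48 = 4 · 12 is spent: a quarter of the p² points must supply twelve good ones per unit
      -- of the order.
      12n≤G : 12 * (m * p) ≤ G
      12n≤G = *-cancelˡ-≤ 4 (begin
        4 * (12 * (m * p))    ≡⟨ l₆ m p ⟩
        48 * m * p            ≤⟨ *-monoˡ-≤ p 48m≤p ⟩
        N                     ≤⟨ N≤4G ⟩
        4 * G                 ∎)
        where
        l₆ : ∀ m p → 4 * (12 * (m * p)) ≡ 48 * m * p
        l₆ = solve-∀
      -- Off the thin sets 8 p³ x y z ≥ XYZ > C m² p², and p ≤ 96 m turns this into x y z ≥ m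
      -- because C ≥ 8 · 96.
      good⇒ : ∀ β → good β ≡ true → m ≤ x β * y β * z β
      good⇒ β gβ with g₂ , tz ← ∧-true (good₂ β) (thin sz β) gβ
                 with g₁ , ty ← ∧-true (good₁ β) (thin sy β) g₂
                 with _ , tx ← ∧-true true (thin sx β) g₁
        = *-cancelʳ-≤ _ _ (96 * 8 * (m * (p * p))) {{m*n≢0 (96 * 8) (m * (p * p)) {{_}} {{m*n≢0 m (p * p) {{m≢0}} {{m*n≢0 p p}}}}}} (begin
          m * (96 * 8 * (m * (p * p)))                      ≤⟨ *-monoʳ-≤ m (*-monoˡ-≤ (m * (p * p)) (≤-trans (≤ᵇ⇒≤ (96 * 8) (272 * 96) tt) C≥)) ⟩
          m * (C * (m * (p * p)))                    ≡⟨ l₇ m p C ⟩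
          C * (m * p * (m * p))                      ≤⟨ <⇒≤ large ⟩
          X * Y * Z                                         ≤⟨ *-mono-≤ (*-mono-≤ (not-thin⇒ sx β tx) (not-thin⇒ sy β ty)) (not-thin⇒ sz β tz) ⟩
          2 * (p * x β) * (2 * (p * y β)) * (2 * (p * z β)) ≡⟨ l₈ p (x β) (y β) (z β) ⟩
          p * (8 * (p * p * (x β * y β * z β)))             ≤⟨ *-monoˡ-≤ _ p≤96m ⟩
          96 * m * (8 * (p * p * (x β * y β * z β)))        ≡⟨ l₉ m p (x β * y β * z β) 96 ⟩
          x β * y β * z β * (96 * 8 * (m * (p * p)))        ∎)
        where
        l₇ : ∀ m p C → m * (C * (m * (p * p))) ≡ C * (m * p * (m * p))
        l₇ = solve-∀
        l₈ : ∀ p x y z → 2 * (p * x) * (2 * (p * y)) * (2 * (p * z)) ≡ p * (8 * (p * p * (x * y * z)))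
        l₈ = solve-∀
        l₉ : ∀ m p t K → K * m * (8 * (p * p * t)) ≡ t * (K * 8 * (m * (p * p)))
        l₉ = solve-∀

    -- Take j about 2pm/Z and g about Y/(2pj). Where y and z are at least half their means, j z ≥ m
    -- and y ≥ g j, so `power-halving` saves a factor 2^g at each touched point of this kind. There
    -- are at least pX/34 of them, and g p X is of order XYZ/(p m), which exceeds a multiple of C n.
    one-narrow : X ≤ 16 * p → Y ≤ m * p → Z ≤ m * p → Large X Y Z →
                 (w : Fin (p * p) → ℕ) → (∀ β → w β + z β ≡ m) →
                 (∀ β → 1 ≤ x β → f β * m ^ y β ≤ w β ^ y β * V) → Conclusion
    one-narrow X≤ Y≤ Z≤ large w w+z hit = from-quotients (ceil-quotient (2 * p * m) Z)
      where
      open ≤-Reasoning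
      N : ℕ
      N = p * p
      positive : ∀ {a b} → C * (m * p * (m * p)) < a → (b ≡ 0 → a ≡ 0) → NonZero b
      positive lt b≡0⇒a≡0 = ≢-nonZero λ b≡0 → contradiction (subst (C * (m * p * (m * p)) <_) (b≡0⇒a≡0 b≡0) lt) λ ()
      instance
        Y≢0 : NonZero Y
        Y≢0 = positive large λ { refl → cong (_* Z) (*-zeroʳ X) }
        Z≢0 : NonZero Z
        Z≢0 = positive large λ { refl → *-zeroʳ (X * Y) }
        n≢0 : NonZero (m * p)
        n≢0 = m*n≢0 m p
        N≢0 : NonZero (p * p)
        N≢0 = m*n≢0 p p
      -- Cancelling Z ≤ n in XYZ > C n² leaves XY ≥ C n, and C n ≥ 272 · 96 m p ≥ 272 p².
      XY-large : ∀ X Y Z → Z ≤ m * p → Large X Y Z → 272 * (p * p) ≤ X * Y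
      XY-large X Y Z Z≤ large = ≤-trans
        (≤-trans (*-monoʳ-≤ 272 (*-monoˡ-≤ p p≤96m)) (≤-trans (≤-reflexive (lem 272 96 m p)) (*-monoˡ-≤ (m * p) C≥)))
        (*-cancelʳ-≤ _ _ (m * p) (begin
          C * (m * p) * (m * p)     ≡⟨ *-assoc C (m * p) (m * p) ⟩
          C * (m * p * (m * p))     ≤⟨ <⇒≤ large ⟩
          X * Y * Z                        ≤⟨ *-monoʳ-≤ (X * Y) Z≤ ⟩
          X * Y * (m * p)                  ∎))
        where
        lem : ∀ a b m p → a * (b * m * p) ≡ a * b * (m * p)
        lem = solve-∀
      T : ℕ
      T = count (touched sx)
      pX≤17T : p * X ≤ 17 * T
      pX≤17T = *-cancelˡ-≤ p (begin
        p * (p * X)            ≡⟨ *-assoc p p X ⟨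
        p * p * X              ≤⟨ count-touched sx ⟩
        (p + X) * T            ≤⟨ *-monoˡ-≤ T (+-monoʳ-≤ p X≤) ⟩
        (p + 16 * p) * T       ≡⟨ lem p T ⟩
        p * (17 * T)           ∎)
        where
        lem : ∀ p T → (p + 16 * p) * T ≡ p * (17 * T)
        lem = solve-∀
      -- 68 = 4 · 17: each thin set uses at most a quarter of the pX/17 points known to be touched,
      -- so that half of them survive both removals.
      few : ∀ {Y y} .{{_ : NonZero Y}} (s : Spread p Y y) → 272 * (p * p) ≤ X * Y → 68 * count (thin s) ≤ p * X
      few {Y} s XY≥ = *-cancelʳ-≤ _ _ Y (begin
        68 * count (thin s) * Y        ≡⟨ *-assoc 68 (count (thin s)) Y ⟩
        68 * (count (thin s) * Y)      ≤⟨ *-monoʳ-≤ 68 (count-thin s) ⟩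
        68 * (4 * (p * p * p))         ≡⟨ lem p ⟩
        p * (272 * (p * p))            ≤⟨ *-monoʳ-≤ p XY≥ ⟩
        p * (X * Y)                    ≡⟨ *-assoc p X Y ⟨
        p * X * Y                      ∎)
        where
        lem : ∀ p → 68 * (4 * (p * p * p)) ≡ p * (272 * (p * p))
        lem = solve-∀
      XZY : Large X Z Y
      XZY = subst (C * (m * p * (m * p)) <_) (lem X Y Z) large
        where
        lem : ∀ a b c → a * b * c ≡ a * c * b
        lem = solve-∀
      good₁ good : Fin N → Bool
      good₁ β = touched sx β ∧ not (thin sy β)
      good  β = good₁ β ∧ not (thin sz β)
      G : ℕ
      G = count good
      pX≤34G : p * X ≤ 34 * G
      pX≤34G = *-cancelˡ-≤ 2 (+-cancelʳ-≤ (p * X + p * X) _ _ (begin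
        2 * (p * X) + (p * X + p * X)                                   ≡⟨ l₁ (p * X) ⟩
        4 * (p * X)                                                     ≤⟨ *-monoʳ-≤ 4 pX≤17T ⟩
        4 * (17 * T)                                                    ≤⟨ *-monoʳ-≤ 4 (*-monoʳ-≤ 17 (≤-trans (count-filter (touched sx) (thin sy)) (+-monoˡ-≤ _ (count-filter good₁ (thin sz))))) ⟩
        4 * (17 * (G + count (thin sz) + count (thin sy)))              ≡⟨ l₂ G (count (thin sz)) (count (thin sy)) ⟩
        2 * (34 * G) + (68 * count (thin sz) + 68 * count (thin sy))    ≤⟨ +-monoʳ-≤ (2 * (34 * G)) (+-mono-≤ (few sz (XY-large X Z Y Y≤ XZY)) (few sy (XY-large X Y Z Z≤ large))) ⟩
        2 * (34 * G) + (p * X + p * X)                                  ∎))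
        where
        l₁ : ∀ a → 2 * a + (a + a) ≡ 4 * a
        l₁ = solve-∀
        l₂ : ∀ G a b → 4 * (17 * (G + a + b)) ≡ 2 * (34 * G) + (68 * a + 68 * b)
        l₂ = solve-∀

      from-quotients : (∃ λ j → 2 * p * m ≤ j * Z × j * Z ≤ 2 * p * m + Z) → Conclusion
      from-quotients (zero , 2pm≤0 , _) =
        contradiction 2pm≤0 (<⇒≱ (>-nonZero⁻¹ (2 * p * m) {{m*n≢0 (2 * p) m {{m*n≢0 2 p}}}}))
      from-quotients (j@(suc _) , 2pm≤jZ , jZ≤) = from-g (floor-quotient Y (2 * p * j) {{2pj≢0}})
        where
        2pj≢0 : NonZero (2 * p * j)
        2pj≢0 = m*n≢0 (2 * p) j {{m*n≢0 2 p}}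
        from-g : (∃ λ g → g * (2 * p * j) ≤ Y × Y < suc g * (2 * p * j)) → Conclusion
        from-g (g , g2pj≤Y , Y<) = begin
          ∏ᶠ N f * 16 ^ (m * p)          ≡⟨ cong (∏ᶠ N f *_) (^-*-assoc 2 4 (m * p)) ⟩
          ∏ᶠ N f * 2 ^ (4 * (m * p))     ≤⟨ *-monoʳ-≤ (∏ᶠ N f) (^-monoʳ-≤ 2 4n≤gG) ⟩
          ∏ᶠ N f * 2 ^ (g * G)           ≡⟨ cong (∏ᶠ N f *_) (^-*-assoc 2 g G) ⟨
          ∏ᶠ N f * (2 ^ g) ^ G           ≤⟨ ∏ᶠ-bound f good V 1 (2 ^ g) f≤V halved ⟩
          1 ^ G * V ^ N                  ≡⟨ trans (cong (_* V ^ N) (^-zeroˡ G)) (*-identityˡ (V ^ N)) ⟩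
          V ^ N                          ∎
          where
          -- Both roundings enter here: Y < (g + 1) 2pj, and jZ ≤ 2pm + Z ≤ 3pm.
          Cm≤ : C * m ≤ 6 * (X * suc g)
          Cm≤ = *-cancelʳ-≤ _ _ (m * (p * p)) {{m*n≢0 m (p * p)}} (begin
            C * m * (m * (p * p))                     ≡⟨ l₁ C m p ⟩
            C * (m * p * (m * p))                     ≤⟨ <⇒≤ large ⟩
            X * Y * Z                                        ≤⟨ *-monoˡ-≤ Z (*-monoʳ-≤ X (<⇒≤ Y<)) ⟩
            X * (suc g * (2 * p * j)) * Z                    ≡⟨ l₂ X (suc g) p j Z ⟩
            X * suc g * (2 * p) * (j * Z)                    ≤⟨ *-monoʳ-≤ (X * suc g * (2 * p)) (≤-trans jZ≤ (+-monoʳ-≤ (2 * p * m) Z≤)) ⟩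
            X * suc g * (2 * p) * (2 * p * m + m * p)        ≡⟨ l₃ (X * suc g) p m ⟩
            6 * (X * suc g) * (m * (p * p))                  ∎)
            where
            l₁ : ∀ C m p → C * m * (m * (p * p)) ≡ C * (m * p * (m * p))
            l₁ = solve-∀
            l₂ : ∀ X g p j Z → X * (g * (2 * p * j)) * Z ≡ X * g * (2 * p) * (j * Z)
            l₂ = solve-∀
            l₃ : ∀ t p m → t * (2 * p) * (2 * p * m + m * p) ≡ 6 * t * (m * (p * p))
            l₃ = solve-∀
          -- Rounding must not lose the whole saving. For g = 0 narrowness would give C m ≤ 6X ≤ 96p
          -- ≤ 96² m, against C > 96².
          g≢0 : g ≢ 0
          g≢0 refl = <⇒≱ (*-monoˡ-< m (≤-trans (≤ᵇ⇒≤ (suc (96 * 96)) (272 * 96) tt) C≥)) (begin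
            C * m            ≤⟨ Cm≤ ⟩
            6 * (X * 1)             ≤⟨ *-monoʳ-≤ 6 (≤-trans (≤-reflexive (*-identityʳ X)) X≤) ⟩
            6 * (16 * p)            ≡⟨ *-assoc 6 16 p ⟨
            96 * p                  ≤⟨ *-monoʳ-≤ 96 p≤96m ⟩
            96 * (96 * m)           ≡⟨ *-assoc 96 96 m ⟨
            96 * 96 * m             ∎)
          1+g≤2g : suc g ≤ 2 * g
          1+g≤2g = ≤-trans (+-monoˡ-≤ g (n≢0⇒n>0 g≢0)) (≤-reflexive (cong (g +_) (sym (+-identityʳ g))))
          -- The target is 16 = 2^4 per unit of the order; 408 = 12 · 34 combines `Cm≤`, the bound g
          -- + 1 ≤ 2g and `pX≤34G`.
          4n≤gG : 4 * (m * p) ≤ g * G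
          4n≤gG = *-cancelˡ-≤ 408 (begin
            408 * (4 * (m * p))             ≡⟨ l₀ 408 (m * p) ⟩
            408 * 4 * (m * p)               ≤⟨ *-monoˡ-≤ (m * p) (≤-trans (≤ᵇ⇒≤ (408 * 4) (272 * 96) tt) C≥) ⟩
            C * (m * p)              ≡⟨ *-assoc C m p ⟨
            C * m * p                ≤⟨ *-monoˡ-≤ p Cm≤ ⟩
            6 * (X * suc g) * p             ≤⟨ *-monoˡ-≤ p (*-monoʳ-≤ 6 (*-monoʳ-≤ X 1+g≤2g)) ⟩
            6 * (X * (2 * g)) * p           ≡⟨ l₁ X g p ⟩
            12 * g * (p * X)                ≤⟨ *-monoʳ-≤ (12 * g) pX≤34G ⟩
            12 * g * (34 * G)               ≡⟨ l₂ g G ⟩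
            408 * (g * G)                   ∎)
            where
            l₀ : ∀ a n → a * (4 * n) ≡ a * 4 * n
            l₀ = solve-∀
            l₁ : ∀ X g p → 6 * (X * (2 * g)) * p ≡ 12 * g * (p * X)
            l₁ = solve-∀
            l₂ : ∀ g G → 12 * g * (34 * G) ≡ 408 * (g * G)
            l₂ = solve-∀
          halved : ∀ β → good β ≡ true → f β * 2 ^ g ≤ 1 * V
          halved β gβ with g₁ , tz ← ∧-true (good₁ β) (thin sz β) gβ
                      with t , ty ← ∧-true (touched sx β) (thin sy β) g₁
            = *-cancelʳ-≤ _ _ (m ^ y β) {{m^n≢0 m (y β)}} (begin
              f β * 2 ^ g * m ^ y β      ≡⟨ l₁ (f β) (2 ^ g) (m ^ y β) ⟩
              f β * m ^ y β * 2 ^ g      ≤⟨ *-monoˡ-≤ (2 ^ g) (hit β (true-does (1 ≤? x β) t)) ⟩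
              w β ^ y β * V * 2 ^ g      ≡⟨ l₁ (w β ^ y β) V (2 ^ g) ⟩
              w β ^ y β * 2 ^ g * V      ≤⟨ *-monoˡ-≤ V (power-halving (w β) (z β) (y β) g j (w+z β) m≤jz gj≤y) ⟩
              m ^ y β * V                ≡⟨ l₂ (m ^ y β) V ⟩
              1 * V * m ^ y β            ∎)
            where
            l₁ : ∀ a b c → a * b * c ≡ a * c * b
            l₁ = solve-∀
            l₂ : ∀ a b → a * b ≡ 1 * b * a
            l₂ = solve-∀
            m≤jz : m ≤ j * z β
            m≤jz = *-cancelˡ-≤ (2 * p) {{m*n≢0 2 p}} (begin
              2 * p * m                  ≤⟨ 2pm≤jZ ⟩
              j * Z                      ≤⟨ *-monoʳ-≤ j (not-thin⇒ sz β tz) ⟩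
              j * (2 * (p * z β))        ≡⟨ l₃ j p (z β) ⟩
              2 * p * (j * z β)          ∎)
              where
              l₃ : ∀ j p z → j * (2 * (p * z)) ≡ 2 * p * (j * z)
              l₃ = solve-∀
            gj≤y : g * j ≤ y β
            gj≤y = *-cancelˡ-≤ (2 * p) {{m*n≢0 2 p}} (begin
              2 * p * (g * j)            ≡⟨ l₃ g j p ⟩
              g * (2 * p * j)            ≤⟨ g2pj≤Y ⟩
              Y                          ≤⟨ not-thin⇒ sy β ty ⟩
              2 * (p * y β)              ≡⟨ *-assoc 2 p (y β) ⟨
              2 * p * y β                ∎)
              where
              l₃ : ∀ g j p → 2 * p * (g * j) ≡ g * (2 * p * j)
              l₃ = solve-∀

-- The affine plane over a prime field

-- Euclid's argument: a prime factor of b! + 1 that is at most b would also divide b!, hence 1.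
∃-prime> : ∀ b → ∃ λ p → Prime p × b < p
∃-prime> b with factorise (suc (b !))
... | record { factors = [] ; isFactorisation = eq } =
  contradiction (ℕ-suc-injective eq) (≢-nonZero⁻¹ (b !) {{b !≢0}})
... | record { factors = p ∷ ps ; isFactorisation = eq ; factorsPrime = p-prime ∷ᵃ _ } with p ≤? b
...   | no  p≰b = p , p-prime , ≰⇒> p≰b
...   | yes p≤b = contradiction p-prime (subst (¬_ ∘ Prime) (sym p≡1) ¬prime[1])
  where
  p∣p! : ∀ {p} → Prime p → p ∣ p !
  p∣p! {zero}  zero-prime = contradiction zero-prime ¬prime[0]
  p∣p! {suc k} _          = m∣m*n (k !)
  p≡1 : p ≡ 1
  p≡1 = ∣1⇒≡1 (∣m+n∣m⇒∣n (subst (p ∣_) (trans (sym eq) (sym (+-comm (b !) 1))) (m∣m*n _))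
    (∣-trans (p∣p! p-prime) (m≤n⇒m!∣n! p≤b)))

module _ {p : ℕ} .{{_ : NonZero p}} where

  %-cong-+ʳ : ∀ {a b} c → a % p ≡ b % p → (a + c) % p ≡ (b + c) % p
  %-cong-+ʳ {a} {b} c eq = trans (%-distribˡ-+ a c p)
    (trans (cong (λ r → (r + c % p) % p) eq) (sym (%-distribˡ-+ b c p)))

  %-absorb⇒∣ : ∀ a d → a % p ≡ (a + d) % p → p ∣ d
  %-absorb⇒∣ a d eq = ∣m+n∣m⇒∣n (divides ((a + d) / p) (+-cancelˡ-≡ (a % p) _ _ (begin
    a % p + (a / p * p + d)               ≡⟨ +-assoc (a % p) (a / p * p) d ⟨
    a % p + a / p * p + d                 ≡⟨ cong (_+ d) (m≡m%n+[m/n]*n a p) ⟨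
    a + d                                 ≡⟨ m≡m%n+[m/n]*n (a + d) p ⟩
    (a + d) % p + (a + d) / p * p         ≡⟨ cong (_+ (a + d) / p * p) eq ⟨
    a % p + (a + d) / p * p               ∎))) (divides (a / p) refl)
    where open ≡-Reasoning

  ∣-small⇒≡0 : ∀ {d} → d < p → p ∣ d → d ≡ 0
  ∣-small⇒≡0 {zero}  d<p p∣d = refl
  ∣-small⇒≡0 {suc d} d<p p∣d = contradiction (∣⇒≤ p∣d) (<⇒≱ d<p)

  private
    %-cancelʳ-ordered : ∀ {a b} c → a ≤ b → b < p → (a + c) % p ≡ (b + c) % p → a ≡ b
    %-cancelʳ-ordered {a} c a≤b b<p eq with d , refl ← m≤n⇒∃[o]m+o≡n a≤b =
      sym (trans (cong (a +_) (∣-small⇒≡0 (≤-<-trans (m≤n+m d a) b<p)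
        (%-absorb⇒∣ (a + c) d (trans eq (cong (_% p) (lem a d c)))))) (+-identityʳ a))
      where
      lem : ∀ a d c → a + d + c ≡ a + c + d
      lem = solve-∀

  %-cancelʳ : ∀ {a b} c → a < p → b < p → (a + c) % p ≡ (b + c) % p → a ≡ b
  %-cancelʳ {a} {b} c a<p b<p eq with ≤-total a b
  ... | inj₁ a≤b = %-cancelʳ-ordered c a≤b b<p eq
  ... | inj₂ b≤a = sym (%-cancelʳ-ordered c b≤a a<p (sym eq))

  residue : ℕ → Fin p
  residue a = fromℕ< (m%n<n a p)

  residue-≡ : ∀ {a b} → residue a ≡ residue b → a % p ≡ b % p
  residue-≡ {a} {b} eq = trans (sym (toℕ-fromℕ< (m%n<n a p))) (trans (cong toℕ eq) (toℕ-fromℕ< (m%n<n b p)))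

  -- Instantiated at modulus `m`, this is the group from which the local squares are scrambled.
  _⊞_ : Fin p → Fin p → Fin p
  a ⊞ b = residue (toℕ a + toℕ b)

  ⊞-injˡ : ∀ b → Injective _≡_ _≡_ (_⊞ b)
  ⊞-injˡ b {a} {a′} eq = toℕ-injective (%-cancelʳ (toℕ b) (toℕ<n a) (toℕ<n a′) (residue-≡ eq))

  ⊞-injʳ : ∀ a → Injective _≡_ _≡_ (a ⊞_)
  ⊞-injʳ a {b} {b′} eq = ⊞-injˡ a (trans (cong residue (+-comm (toℕ b) (toℕ a)))
    (trans eq (cong residue (+-comm (toℕ a) (toℕ b′)))))

module AffinePlane {p : ℕ} (p-prime : Prime p) where

  instance
    p≢0 : NonZero p
    p≢0 = prime⇒nonZero p-prime

  -- The line through (u , v) is v + k u = const, so its slope is -k in the usual sign; the plus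
  -- avoids subtracting residues.
  intercept : Fin p → Fin (p * p) → Fin p
  intercept k β = let u , v = remQuot {p} p β in residue (toℕ v + toℕ k * toℕ u)

  private
    -- With u ≤ u′ and k < k′ the two congruences give p ∣ (k′ − k)(u′ − u).
    same-abscissa : ∀ {k k′ u u′ v v′} → k < k′ → k′ < p → u ≤ u′ → u′ < p →
      (v + k * u) % p ≡ (v′ + k * u′) % p → (v + k′ * u) % p ≡ (v′ + k′ * u′) % p → u ≡ u′
    same-abscissa {k} {k′} {u} {u′} {v} {v′} k<k′ k′<p u≤u′ u′<p eq eq′
      with e , refl ← m≤n⇒∃[o]m+o≡n (<⇒≤ k<k′) with d , refl ← m≤n⇒∃[o]m+o≡n u≤u′
      with euclidsLemma e d p-prime (%-absorb⇒∣ (v + (k + e) * u) (e * d) (trans eq′ (begin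
        (v′ + (k + e) * (u + d)) % p                 ≡⟨ cong (_% p) (l₁ v′ k e u d) ⟩
        (v′ + k * (u + d) + (e * u + e * d)) % p     ≡⟨ %-cong-+ʳ {a = v + k * u} {v′ + k * (u + d)} (e * u + e * d) eq ⟨
        (v + k * u + (e * u + e * d)) % p            ≡⟨ cong (_% p) (l₂ v k e u d) ⟩
        (v + (k + e) * u + e * d) % p                ∎)))
      where
      open ≡-Reasoning
      l₁ : ∀ v k e u d → v + (k + e) * (u + d) ≡ v + k * (u + d) + (e * u + e * d)
      l₁ = solve-∀
      l₂ : ∀ v k e u d → v + k * u + (e * u + e * d) ≡ v + (k + e) * u + e * d
      l₂ = solve-∀
    ... | inj₂ p∣d = sym (trans (cong (u +_) (∣-small⇒≡0 (≤-<-trans (m≤n+m d u) u′<p) p∣d)) (+-identityʳ u))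
    ... | inj₁ p∣e = contradiction k<k′ (≤⇒≯ (≤-reflexive
      (trans (cong (k +_) (∣-small⇒≡0 (≤-<-trans (m≤n+m e k) k′<p) p∣e)) (+-identityʳ k))))

    abscissa : ∀ {k k′ u u′ v v′} → k ≢ k′ → k < p → k′ < p → u < p → u′ < p →
      (v + k * u) % p ≡ (v′ + k * u′) % p → (v + k′ * u) % p ≡ (v′ + k′ * u′) % p → u ≡ u′
    abscissa {k} {k′} {u} {u′} k≢k′ k<p k′<p u<p u′<p eq eq′ with <-cmp k k′ | ≤-total u u′
    ... | tri≈ _ k≡k′ _ | _         = contradiction k≡k′ k≢k′
    ... | tri< k<k′ _ _ | inj₁ u≤u′ = same-abscissa k<k′ k′<p u≤u′ u′<p eq eq′
    ... | tri< k<k′ _ _ | inj₂ u′≤u = sym (same-abscissa k<k′ k′<p u′≤u u<p (sym eq) (sym eq′))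
    ... | tri> _ _ k′<k | inj₁ u≤u′ = same-abscissa k′<k k<p u≤u′ u′<p eq′ eq
    ... | tri> _ _ k′<k | inj₂ u′≤u = sym (same-abscissa k′<k k<p u′≤u u<p (sym eq′) (sym eq))

  intercept-orthogonal : Orthogonal intercept
  intercept-orthogonal {k} {k′} k≢k′ {β} {β′} eq eq′ = begin
    β                                  ≡⟨ combine-remQuot {p} p β ⟨
    uncurry combine (remQuot {p} p β)  ≡⟨ cong₂ combine u≡u′ v≡v′ ⟩
    uncurry combine (remQuot {p} p β′) ≡⟨ combine-remQuot {p} p β′ ⟩
    β′                                 ∎
    where
    open ≡-Reasoning
    u v u′ v′ : Fin p
    u  = proj₁ (remQuot {p} p β)
    v  = proj₂ (remQuot {p} p β)
    u′ = proj₁ (remQuot {p} p β′)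
    v′ = proj₂ (remQuot {p} p β′)
    u≡u′ : u ≡ u′
    u≡u′ = toℕ-injective (abscissa {toℕ k} {toℕ k′} {toℕ u} {toℕ u′} {toℕ v} {toℕ v′} (k≢k′ ∘ toℕ-injective) (toℕ<n k) (toℕ<n k′) (toℕ<n u) (toℕ<n u′)
      (residue-≡ {a = toℕ v + toℕ k * toℕ u} {toℕ v′ + toℕ k * toℕ u′} eq)
      (residue-≡ {a = toℕ v + toℕ k′ * toℕ u} {toℕ v′ + toℕ k′ * toℕ u′} eq′))
    v≡v′ : v ≡ v′
    v≡v′ = toℕ-injective (%-cancelʳ (toℕ k * toℕ u) (toℕ<n v) (toℕ<n v′)
      (trans (residue-≡ {a = toℕ v + toℕ k * toℕ u} {toℕ v′ + toℕ k * toℕ u′} eq) (cong (λ u → (toℕ v′ + toℕ k * toℕ u) % p) (sym u≡u′))))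

-- Disjoint families of slopes

module _ {m p : ℕ} where

  slope : ∀ o → o + m ≤ p → Fin m → Fin p
  slope o o+m≤p a = fromℕ< (<-≤-trans (+-monoʳ-< o (toℕ<n a)) o+m≤p)

  toℕ-slope : ∀ o (h : o + m ≤ p) a → toℕ (slope o h a) ≡ o + toℕ a
  toℕ-slope o h a = toℕ-fromℕ< (<-≤-trans (+-monoʳ-< o (toℕ<n a)) h)

  slope-injective : ∀ o (h : o + m ≤ p) → Injective _≡_ _≡_ (slope o h)
  slope-injective o h {a} {b} eq = toℕ-injective (+-cancelˡ-≡ o _ _
    (trans (sym (toℕ-slope o h a)) (trans (cong toℕ eq) (toℕ-slope o h b))))

  slope-disjoint : ∀ o o′ (h : o + m ≤ p) (h′ : o′ + m ≤ p) → o + m ≤ o′ → ∀ a b → slope o h a ≢ slope o′ h′ b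
  slope-disjoint o o′ h h′ o+m≤o′ a b eq = <⇒≢ (<-≤-trans (+-monoʳ-< o (toℕ<n a)) (≤-trans o+m≤o′ (m≤m+n o′ (toℕ b))))
    (trans (sym (toℕ-slope o h a)) (trans (cong toℕ eq) (toℕ-slope o′ h′ b)))

-- Enumeration of subsets

length-cartesianProductWith : ∀ (f : A → B → K) xs ys →
                              length (cartesianProductWith f xs ys) ≡ length xs * length ys
length-cartesianProductWith f []       ys = refl
length-cartesianProductWith f (x ∷ xs) ys = trans (length-++ (map (f x) ys))
  (cong₂ _+_ (length-map (f x) ys) (length-cartesianProductWith f xs ys))

subsets : ∀ n → List (Subset n)
subsets zero    = [] ∷ []
subsets (suc n) = cartesianProductWith _∷_ (true ∷ false ∷ []) (subsets n)

∈-subsets : ∀ {n} (X : Subset n) → X ∈ subsets n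
∈-subsets []          = here refl
∈-subsets (true ∷ X)  = ∈-cartesianProductWith⁺ _∷_ {xs = true ∷ false ∷ []} (here refl) (∈-subsets X)
∈-subsets (false ∷ X) = ∈-cartesianProductWith⁺ _∷_ {xs = true ∷ false ∷ []} (there (here refl)) (∈-subsets X)

length-subsets : ∀ n → length (subsets n) ≡ 2 ^ n
length-subsets zero    = refl
length-subsets (suc n) = trans (length-cartesianProductWith _∷_ (true ∷ false ∷ []) (subsets n)) (cong (2 *_) (length-subsets n))

-- The union bound over all boxes

module Construction {p m : ℕ} (p-prime : Prime p) .{{_ : NonZero m}} (48m≤p : 48 * m ≤ p) (p≤96m : p ≤ 96 * m)
  (C : ℕ) (C≥ : 272 * 96 ≤ C) where

  open AffinePlane p-prime
  open Net (nonTrivial⇒n>1 p {{prime⇒nonTrivial p-prime}}) intercept intercept-orthogonal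
  open Scrambled {m} _⊞_ ⊞-injˡ ⊞-injʳ

  order N V : ℕ
  order = m * p
  N = p * p
  V = m ! * m !

  private
    fits : ∀ i → suc i ≤ 48 → i * m + m ≤ p
    fits i i<48 = ≤-trans (≤-reflexive (+-comm (i * m) m)) (≤-trans (*-monoˡ-≤ m i<48) 48m≤p)

    fits₀ : 0 * m + m ≤ p
    fits₀ = fits 0 (s≤s z≤n)
    fits₁ : 1 * m + m ≤ p
    fits₁ = fits 1 (s≤s (s≤s z≤n))
    fits₂ : 2 * m + m ≤ p
    fits₂ = fits 2 (s≤s (s≤s (s≤s z≤n)))

  row col symbol : Fin m → Fin p
  row = slope (0 * m) fits₀
  col = slope (1 * m) fits₁
  symbol = slope (2 * m) fits₂

  Box : Set
  Box = Subset order × Subset order × Subset order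

  boxes : List Box
  boxes = cartesianProduct (subsets order) (cartesianProduct (subsets order) (subsets order))

  tooLarge? : ∀ (X Y Z : Subset order) → Dec (C * (order * order) < ∣ X ∣ * ∣ Y ∣ * ∣ Z ∣)
  tooLarge? X Y Z = suc (C * (order * order)) ≤? ∣ X ∣ * ∣ Y ∣ * ∣ Z ∣

  weight : Box → ℕ
  weight (X , Y , Z) = ⟦ does (tooLarge? X Y Z) ⟧

  missAt : Fin N → Box → Ω → ℕ
  missAt β (X , Y , Z) = miss (trace row X β) (trace col Y β) (trace symbol Z β)

  missesAt : Box → Fin N → ℕ
  missesAt b β = ∑ Ωs (missAt β b)

  spread : ∀ (s : Fin m → Fin p) → Injective _≡_ _≡_ s → ∀ X → Spread p ∣ X ∣ (λ β → count (trace s X β))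
  spread s s-inj X = record { total = ∑-count-trace s X ; energy = ∑-count-trace² s s-inj X }

  ∏-misses : ∀ X Y Z → C * (order * order) < ∣ X ∣ * ∣ Y ∣ * ∣ Z ∣ →
             ∏ᶠ N (missesAt (X , Y , Z)) * 16 ^ order ≤ V ^ N
  ∏-misses X Y Z large = cases (≤-total (16 * p) ∣ X ∣) (≤-total (16 * p) ∣ Y ∣) (≤-total (16 * p) ∣ Z ∣)
    where
    x y z : Fin N → Fin m → Bool
    x = trace row X
    y = trace col Y
    z = trace symbol Z
    sx : Spread p ∣ X ∣ (count ∘ x)
    sx = spread row (slope-injective (0 * m) fits₀) X
    sy : Spread p ∣ Y ∣ (count ∘ y)
    sy = spread col (slope-injective (1 * m) fits₁) Y
    sz : Spread p ∣ Z ∣ (count ∘ z)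
    sz = spread symbol (slope-injective (2 * m) fits₂) Z
    open Volume p m V 48m≤p p≤96m C C≥ (missesAt (X , Y , Z)) (λ β → misses≤ (x β) (y β) (z β))
    complement : ∀ (P : Fin m → Bool) → count (not ∘ P) + count P ≡ m
    complement P = trans (+-comm (count (not ∘ P)) (count P)) (count-not P)
    l₁ : ∀ a b c → a * b * c ≡ b * a * c
    l₁ = solve-∀
    l₂ : ∀ a b c → a * b * c ≡ c * b * a
    l₂ = solve-∀
    cases : 16 * p ≤ ∣ X ∣ ⊎ ∣ X ∣ ≤ 16 * p → 16 * p ≤ ∣ Y ∣ ⊎ ∣ Y ∣ ≤ 16 * p → 16 * p ≤ ∣ Z ∣ ⊎ ∣ Z ∣ ≤ 16 * p → Conclusion
    cases (inj₁ X≥) (inj₁ Y≥) (inj₁ Z≥) = all-wide sx sy sz X≥ Y≥ Z≥ large λ β → misses-XYZ (x β) (y β) (z β)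
    -- The narrow family is the one that only has to be present at a point; of the other two, one
    -- supplies the exponent and one the complement `w`. The three local bounds are matched to these
    -- roles.
    cases (inj₂ X≤) _ _ = one-narrow sx sy sz X≤ (∣p∣≤n Y) (∣p∣≤n Z) large
      (λ β → count (not ∘ z β)) (λ β → complement (z β)) (λ β → misses-X (x β) (y β) (z β))
    cases _ (inj₂ Y≤) _ = one-narrow sy sx sz Y≤ (∣p∣≤n X) (∣p∣≤n Z)
      (subst (C * (order * order) <_) (l₁ (∣ X ∣) (∣ Y ∣) (∣ Z ∣)) large)
      (λ β → count (not ∘ z β)) (λ β → complement (z β)) (λ β → misses-Y (x β) (y β) (z β))
    cases _ _ (inj₂ Z≤) = one-narrow sz sy sx Z≤ (∣p∣≤n Y) (∣p∣≤n X)
      (subst (C * (order * order) <_) (l₂ (∣ X ∣) (∣ Y ∣) (∣ Z ∣)) large)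
      (λ β → count (not ∘ x β)) (λ β → complement (x β)) (λ β → misses-Z (x β) (y β) (z β))

  order≢0 : NonZero order
  order≢0 = m*n≢0 m p

  V≢0 : NonZero V
  V≢0 = m*n≢0 (m !) (m !) {{m !≢0}} {{m !≢0}}

  length-Ωs : length Ωs ≡ V
  length-Ωs = trans (length-cartesianProductWith _,_ (perms m) (perms m)) (cong₂ _*_ (length-perms m) (length-perms m))

  length-boxes : length boxes ≡ 8 ^ order
  length-boxes = begin
    length boxes                                      ≡⟨ length-cartesianProductWith _,_ (subsets order) _ ⟩
    length (subsets order) * length (cartesianProduct (subsets order) (subsets order))
      ≡⟨ cong (length (subsets order) *_) (length-cartesianProductWith _,_ (subsets order) (subsets order)) ⟩
    length (subsets order) * (length (subsets order) * length (subsets order))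
      ≡⟨ cong (λ l → l * (l * l)) (length-subsets order) ⟩
    2 ^ order * (2 ^ order * 2 ^ order)                           ≡⟨ cong (2 ^ order *_) (^-distribˡ-+-* 2 order order) ⟨
    2 ^ order * 2 ^ (order + order)                               ≡⟨ ^-distribˡ-+-* 2 order (order + order) ⟨
    2 ^ (order + (order + order))                                 ≡⟨ cong (2 ^_) (lem order) ⟩
    2 ^ (3 * order)                                       ≡⟨ ^-*-assoc 2 3 order ⟨
    8 ^ order                                             ∎
    where
    open ≡-Reasoning
    lem : ∀ order → order + (order + order) ≡ 3 * order
    lem = solve-∀

  expected-bad<1 : ∑ boxes (λ b → weight b * ∏ᶠ N (missesAt b)) < length Ωs ^ N
  expected-bad<1 = *-cancelʳ-< (16 ^ order) _ _ (begin-strict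
    ∑ boxes (λ b → weight b * ∏ᶠ N (missesAt b)) * 16 ^ order    ≡⟨ ∑-*ʳ boxes _ (16 ^ order) ⟨
    ∑ boxes (λ b → weight b * ∏ᶠ N (missesAt b) * 16 ^ order)    ≤⟨ ∑-mono boxes single ⟩
    ∑ boxes (λ _ → V ^ N)                                    ≡⟨ trans (∑-const boxes (V ^ N)) (cong (_* V ^ N) length-boxes) ⟩
    -- The slack of the union bound, strict because the order is nonzero.
    8 ^ order * V ^ N                                            <⟨ *-monoˡ-< (V ^ N) {{m^n≢0 V N {{V≢0}}}} (^-monoˡ-< order {{order≢0}} (≤ᵇ⇒≤ 9 16 tt)) ⟩
    16 ^ order * V ^ N                                           ≡⟨ *-comm (16 ^ order) (V ^ N) ⟩
    V ^ N * 16 ^ order                                           ≡⟨ cong (λ l → l ^ N * 16 ^ order) length-Ωs ⟨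
    length Ωs ^ N * 16 ^ order                                   ∎)
    where
    open ≤-Reasoning
    single : ∀ b → weight b * ∏ᶠ N (missesAt b) * 16 ^ order ≤ V ^ N
    single (X , Y , Z) with does (tooLarge? X Y Z) in eq
    ... | false = z≤n
    ... | true  = subst (λ t → t * 16 ^ order ≤ V ^ N) (sym (*-identityˡ (∏ᶠ N (missesAt (X , Y , Z))))) (∏-misses X Y Z (true-does (tooLarge? X Y Z) eq))

  chosen : ∃ λ (ω : Fin N → Ω) → ∑ boxes (λ b → weight b * ∏ᶠ N λ β → missAt β b (ω β)) < 1
  chosen = choose N Ωs boxes weight missAt expected-bad<1

  local : Fin N → Ω
  local = proj₁ chosen

  open Assembled {m} row col symbol
    (slope-disjoint (0 * m) (1 * m) fits₀ fits₁ (≤-reflexive (+-comm 0 m)))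
    (slope-disjoint (0 * m) (2 * m) fits₀ fits₂ (m≤m+n m (1 * m)))
    (slope-disjoint (1 * m) (2 * m) fits₁ fits₂ (≤-reflexive (+-comm (1 * m) m)))
    (λ β a b → local β [ a , b ]) (λ β b → []-injˡ (local β) b) (λ β a → []-injʳ (local β) a)

  square : LatinSquare order
  square = latinSquare

  -- An empty box is missed by the local square at every point, so an oversized one would contribute
  -- a summand one to a sum that `chosen` keeps below one.
  bounded : εBoundedBy square (C * (order * order))
  bounded X Y Z empty = ≮⇒≥ λ large → contradiction (proj₂ chosen) (≤⇒≯ (begin
    1
      ≡⟨ cong₂ _*_ (cong ⟦_⟧ (does-true (tooLarge? X Y Z) large)) (∏ᶠ-ones all-miss) ⟨
    weight (X , Y , Z) * ∏ᶠ N (λ β → missAt β (X , Y , Z) (local β))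
      ≤⟨ ∑-∈ (λ b → weight b * ∏ᶠ N (λ β → missAt β b (local β)))
           (∈-cartesianProduct⁺ (∈-subsets X) (∈-cartesianProduct⁺ (∈-subsets Y) (∈-subsets Z))) ⟩
    ∑ boxes (λ b → weight b * ∏ᶠ N (λ β → missAt β b (local β))) ∎))
    where
    open ≤-Reasoning
    all-miss : ∀ β → missAt β (X , Y , Z) (local β) ≡ 1
    all-miss β = miss-complete (trace row X β) (trace col Y β) (trace symbol Z β) (local β)
      λ { (a , b , Xa , Yb , Zab) → empty⇒no-hit empty β a b Xa Yb Zab }

-- Rounding loses less than 48, which is at most 48 m as m is positive; hence the factor 96.
∃-48th : ∀ p → 48 ≤ p → ∃ λ m → 0 < m × 48 * m ≤ p × p ≤ 96 * m
∃-48th p 48≤p = p / 48 , 0<m , ≤-trans (≤-reflexive (*-comm 48 (p / 48))) (m/n*n≤m p 48) , (begin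
  p                               ≡⟨ m≡m%n+[m/n]*n p 48 ⟩
  p % 48 + p / 48 * 48            ≤⟨ +-monoˡ-≤ (p / 48 * 48) (<⇒≤ (m%n<n p 48)) ⟩
  48 + p / 48 * 48                ≤⟨ +-monoˡ-≤ (p / 48 * 48) (m≤m*n 48 (p / 48) {{>-nonZero 0<m}}) ⟩
  48 * (p / 48) + p / 48 * 48     ≡⟨ lem (p / 48) ⟩
  96 * (p / 48)                   ∎)
  where
  open ≤-Reasoning
  lem : ∀ m → 48 * m + m * 48 ≡ 96 * m
  lem = solve-∀
  0<m : 0 < p / 48
  0<m = m≥n⇒m/n>0 48≤p

bounded-for : ∀ C → 0 < C → 272 * 96 ≤ C →
  Σ ℕ λ C → 0 < C × (∀ m → ∃ λ n → m ≤ n × 0 < n × Σ (LatinSquare n) λ Sq → εBoundedBy Sq (C * (n * n)))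
bounded-for C 0<C C≥ = C , 0<C , λ b →
  -- The bound `b + 48` serves twice: p ≥ 48 makes the number of slopes positive, and p ≥ b makes
  -- the order at least b.
  let p , p-prime , b+48<p = ∃-prime> (b + 48)
      m , 0<m , 48m≤p , p≤96m = ∃-48th p (≤-trans (m≤n+m 48 b) (<⇒≤ b+48<p))
      b≤p = ≤-trans (m≤m+n b 48) (<⇒≤ b+48<p)
  in  m * p , ≤-trans b≤p (m≤n*m p m {{>-nonZero 0<m}}) ,
      *-mono-< 0<m (≤-<-trans z≤n b+48<p) ,
      (let open Construction p-prime {{>-nonZero 0<m}} 48m≤p p≤96m C C≥ in square , bounded)

theorem1p3 : Σ ℕ λ C → 0 < C × (∀ m → ∃ λ n → m ≤ n × 0 < n × Σ (LatinSquare n) λ Sq → εBoundedBy Sq (C * (n * n)))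
theorem1p3 = bounded-for (272 * 96) (s≤s z≤n) ≤-refl
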